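{- (a) Let $G=c_1+c_2+\cdots+c_n$ be a disjoint union of $n\ge 1$ chains of lengths $c_1,\dots,c_n\ge 4$. Then $v(G)=cv(G)=4+\sum_{i=1}^n(c_i-4)\ge 4$. (b) Let $G=c_1+c_2+\cdots+c_n$ be a disjoint union of $n\ge 1$ chains of lengths $c_1,\dots,c_n\ge 3$, and let $c=cv(G)=4+\sum_{i=1}^n(c_i-4)$. If $c\ge 1$ then $v(G)=c$. If $c\le 0$ then $v(G)\in\{1,2\}$ and $v(G)\equiv c \pmod 2$.
   Context: Game. A dots and boxes game (position) $G$ consists of a finite set of unclaimed boxes and a finite set of undrawn lines, each undrawn line bordering either exactly one box or exactly two distinct boxes, each box being bordered by at least one and at most four undrawn lines. Two players play. The player to move draws (removes) an undrawn line; every box none of whose bordering lines is still undrawn is then claimed by that player. If the move claims at least one box the same player must move again (if a line remains); otherwise the other player moves. Claiming a box when possible is not compulsory. The game ends when no line remains. Each player maximises (own boxes) minus (opponent's boxes), counting only boxes claimed from $G$ onwards. Value. $v(G)$ is the net score, under optimal play, of the player who is NOT to move in $G$. Equivalently, $v(G)=0$ if $G$ has no undrawn lines, and otherwise $v(G)=\min_m v(G;m)$ over undrawn lines $m$, where, if drawing $m$ claims $k$ boxes and leaves the position $G_m$, then $v(G;m)=v(G_m)-k$ if $k\ge1$ and $v(G;m)=-v(G_m)$ if $k=0$. Sums and chains. $G+H$ is the disjoint union. An $n$-chain (chain of length $n$), denoted $n$, is the position with boxes $b_1,\dots,b_n$ and lines $e_0,\dots,e_n$, where $e_i$ borders $b_i$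 and $b_{i+1}$ for $1\le i\le n-1$, $e_0$ borders only $b_1$ and $e_n$ borders only $b_n$. The number $cv(G)$ is the controlled value; for a non-empty union of chains of lengths $c_i\ge3$ it is $4+\sum_i(c_i-4)$. -}

module Defs where

open import Data.Empty using (⊥; ⊥-elim)
open import Data.Fin.Base using (Fin; zero; suc; inject₁; fromℕ)
open import Data.Fin.Properties using (inject₁-injective; suc-injective)
  renaming (_≟_ to _≟ᶠ_)
open import Data.Integer.Base as ℤ using (ℤ; 0ℤ)
open import Data.List.Base as List using (List; []; _∷_; length; filter; allFin)
open import Data.List.Membership.DecPropositional using () renaming (_∈?_ to member?)
open import Data.List.Membership.Propositional using (_∈_)
open import Data.List.Membership.Propositional.Properties
  using (∈-map⁺; ∈-map⁻; ∈-++⁺ˡ; ∈-++⁺ʳ; ∈-++⁻; ∈-filter⁺; ∈-filter⁻; ∈-allFin)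
open import Data.List.Relation.Binary.Subset.Propositional using (_⊆_)
open import Data.List.Relation.Unary.Any using (here; there)
open import Data.List.Relation.Unary.Unique.Propositional using (Unique; [])
import Data.List.Relation.Unary.Unique.Propositional.Properties as Unique
open import Data.Nat.Base using (ℕ; zero; suc; _+_; _≤_; z≤n; s≤s)
open import Data.Nat.ListAction using (sum)
open import Data.Nat.Properties
  using (≤-trans; ≤-reflexive; ≤-refl; n≤1+n; m≤n⇒m≤1+n; +-identityʳ;
         +-suc; +-mono-≤; _≤?_; _≟_)
open import Data.Product.Base using (_×_; _,_; proj₁; proj₂)
open import Data.Sum.Base using (_⊎_; inj₁; inj₂)
open import Data.Sum.Properties using (inj₁-injective; inj₂-injective)
  renaming (≡-dec to ⊎-≟)
open import Data.Vec.Base as Vec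
  using (Vec; []; _∷_; _∷ʳ_; _++_; count; foldr₁; lookup; removeAt; tabulate)
open import Data.Vec.Properties using (lookup∘tabulate)
open import Data.Vec.Relation.Unary.All as All using (All; []; _∷_)
import Data.Vec.Relation.Unary.All.Properties as All
open import Function.Base using (_∘_)
open import Function.Definitions using (Injective)
open import Relation.Binary.Definitions using (DecidableEquality)
open import Relation.Binary.PropositionalEquality
open import Relation.Nullary using (¬_; yes; no)
open import Relation.Unary using (Pred; Decidable)
open import Level using (0ℓ)

data Line (B : Set) : Set where
  one : B → Line B
  two : (b c : B) → .(b ≢ c) → Line B

ends : ∀ {B} → Line B → List B
ends (one b)     = b ∷ []
ends (two b c _) = b ∷ c ∷ []

mapLine : ∀ {B C} (f : B → C) → Injective _≡_ _≡_ f → Line B → Line C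
mapLine f inj (one b)       = one (f b)
mapLine f inj (two b c b≢c) = two (f b) (f c) (b≢c ∘ inj)

module Degree {B : Set} (_≟ᴮ_ : DecidableEquality B) where

  borders? : (b : B) → Decidable (λ (l : Line B) → b ∈ ends l)
  borders? b l = member? _≟ᴮ_ b (ends l)

  degree : ∀ {n} → Vec (Line B) n → B → ℕ
  degree ls b = count (borders? b) ls

module _ {A : Set} {P : Pred A 0ℓ} (P? : Decidable P) where

  count-++ : ∀ {m n} (xs : Vec A m) (ys : Vec A n) →
             count P? (xs ++ ys) ≡ count P? xs + count P? ys
  count-++ []       ys = refl
  count-++ (x ∷ xs) ys with P? x
  ... | yes _ = cong suc (count-++ xs ys)
  ... | no  _ = count-++ xs ys

  count-∷-≤ : ∀ {n} x (xs : Vec A n) → count P? (x ∷ xs) ≤ suc (count P? xs)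
  count-∷-≤ x xs with P? x
  ... | yes _ = ≤-refl
  ... | no  _ = n≤1+n _

  count-∷-≥ : ∀ {n} x (xs : Vec A n) → count P? xs ≤ count P? (x ∷ xs)
  count-∷-≥ x xs with P? x
  ... | yes _ = n≤1+n _
  ... | no  _ = ≤-refl

  count-∷ʳ-≤ : ∀ {n} (xs : Vec A n) x → count P? (xs ∷ʳ x) ≤ suc (count P? xs)
  count-∷ʳ-≤ []       x = count-∷-≤ x []
  count-∷ʳ-≤ (y ∷ xs) x with P? y
  ... | yes _ = s≤s (count-∷ʳ-≤ xs x)
  ... | no  _ = count-∷ʳ-≤ xs x

  count-∷ʳ-≥ : ∀ {n} (xs : Vec A n) x → count P? xs ≤ count P? (xs ∷ʳ x)
  count-∷ʳ-≥ []       x = z≤n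
  count-∷ʳ-≥ (y ∷ xs) x with P? y
  ... | yes _ = s≤s (count-∷ʳ-≥ xs x)
  ... | no  _ = count-∷ʳ-≥ xs x

  count-positive : ∀ {n} (xs : Vec A n) i → P (lookup xs i) → 1 ≤ count P? xs
  count-positive (x ∷ xs) i       p with P? x
  count-positive (x ∷ xs) i       p | yes _ = s≤s z≤n
  count-positive (x ∷ xs) zero    p | no ¬p = ⊥-elim (¬p p)
  count-positive (x ∷ xs) (suc i) p | no _  = count-positive xs i p

  count-removeAt-≤ : ∀ {n} (xs : Vec A (suc n)) i →
                     count P? (removeAt xs i) ≤ count P? xs
  count-removeAt-≤ (x ∷ xs)         zero    = count-∷-≥ x xs
  count-removeAt-≤ (x ∷ xs@(_ ∷ _)) (suc i) with P? x
  ... | yes _ = s≤s (count-removeAt-≤ xs i)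
  ... | no  _ = count-removeAt-≤ xs i

  count-zero : ∀ {n} (xs : Vec A n) → All (λ x → ¬ P x) xs → count P? xs ≡ 0
  count-zero []       []         = refl
  count-zero (x ∷ xs) (¬p ∷ ¬ps) with P? x
  ... | yes p = ⊥-elim (¬p p)
  ... | no  _ = count-zero xs ¬ps

  count-tabulate-≤1 : ∀ {n} (f : Fin n → A) →
    (∀ i j → P (f i) → P (f j) → i ≡ j) → count P? (tabulate f) ≤ 1
  count-tabulate-≤1 {zero}  f uniq = z≤n
  count-tabulate-≤1 {suc n} f uniq with P? (f zero)
  ... | no  _ = count-tabulate-≤1 (f ∘ suc) λ i j p q → suc-injective (uniq (suc i) (suc j) p q)
  ... | yes p = s≤s (≤-reflexive (count-zero (tabulate (f ∘ suc)) (All.tabulate⁺ {f = f ∘ suc} λ i q → absurd (uniq zero (suc i) p q))))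
    where
    absurd : ∀ {i : Fin n} → ¬ (zero ≡ suc i)
    absurd ()

count-map : ∀ {A C : Set} {P : Pred A 0ℓ} {Q : Pred C 0ℓ}
            (P? : Decidable P) (Q? : Decidable Q) (f : A → C) →
            (∀ x → P x → Q (f x)) → (∀ x → Q (f x) → P x) →
            ∀ {n} (xs : Vec A n) → count Q? (Vec.map f xs) ≡ count P? xs
count-map P? Q? f to from []       = refl
count-map P? Q? f to from (x ∷ xs) with P? x | Q? (f x)
... | yes _ | yes _ = cong suc (count-map P? Q? f to from xs)
... | no  _ | no  _ = count-map P? Q? f to from xs
... | yes p | no ¬q = ⊥-elim (¬q (to x p))
... | no ¬p | yes q = ⊥-elim (¬p (from x q))

count-tabulate-∪ : ∀ {A C D : Set} {P : Pred A 0ℓ} {Q : Pred C 0ℓ} {R : Pred D 0ℓ}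
  (P? : Decidable P) (Q? : Decidable Q) (R? : Decidable R) →
  ∀ {n} (f : Fin n → A) (g : Fin n → C) (h : Fin n → D) →
  (∀ i → P (f i) → Q (g i) ⊎ R (h i)) →
  count P? (tabulate f) ≤ count Q? (tabulate g) + count R? (tabulate h)
count-tabulate-∪ P? Q? R? {zero}  f g h cover = z≤n
count-tabulate-∪ P? Q? R? {suc n} f g h cover
  with ih ← count-tabulate-∪ P? Q? R? (f ∘ suc) (g ∘ suc) (h ∘ suc) (cover ∘ suc)
  with P? (f zero) | Q? (g zero) | R? (h zero)
... | no  _ | yes _ | yes _ = m≤n⇒m≤1+n (≤-trans ih (+-mono-≤ ≤-refl (n≤1+n _)))
... | no  _ | yes _ | no  _ = m≤n⇒m≤1+n ih
... | no  _ | no  _ | yes _ = ≤-trans ih (+-mono-≤ ≤-refl (n≤1+n _))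
... | no  _ | no  _ | no  _ = ih
... | yes _ | yes _ | yes _ = s≤s (≤-trans ih (+-mono-≤ ≤-refl (n≤1+n _)))
... | yes _ | yes _ | no  _ = s≤s ih
... | yes _ | no  _ | yes _ = ≤-trans (s≤s ih) (≤-reflexive (sym (+-suc _ _)))
... | yes p | no ¬q | no ¬r with cover zero p
...   | inj₁ q = ⊥-elim (¬q q)
...   | inj₂ r = ⊥-elim (¬r r)

-- Position n has exactly n undrawn lines.  Box is only a supply of names:
-- the unclaimed boxes are the entries of the list boxes.

record Position (n : ℕ) : Set₁ where
  field
    Box    : Set
    _≟ᴮ_   : DecidableEquality Box
    boxes  : List Box
    lines  : Vec (Line Box) n
  open Degree _≟ᴮ_ public
  field
    unique   : Unique boxes
    closed   : All (λ l → ends l ⊆ boxes) lines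
    degree≥1 : ∀ {b} → b ∈ boxes → 1 ≤ degree lines b
    degree≤4 : ∀ {b} → b ∈ boxes → degree lines b ≤ 4

∅ : Position 0
∅ = record
  { Box      = ⊥
  ; _≟ᴮ_     = λ ()
  ; boxes    = []
  ; lines    = []
  ; unique   = []
  ; closed   = []
  ; degree≥1 = λ ()
  ; degree≤4 = λ ()
  }

module _ {n} (G : Position (suc n)) (m : Fin (suc n)) where
  open Position G

  remaining : Vec (Line Box) n
  remaining = removeAt lines m

  claimed : ℕ
  claimed = length (filter (λ b → degree remaining b ≟ 0) boxes)

  private
    alive? : Decidable (λ b → 1 ≤ degree remaining b)
    alive? b = 1 ≤? degree remaining b

    All-removeAt : ∀ {A : Set} {P : Pred A 0ℓ} {k} {xs : Vec A (suc k)} →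
                   All P xs → ∀ i → All P (removeAt xs i)
    All-removeAt (p ∷ ps)         zero    = ps
    All-removeAt (p ∷ ps@(_ ∷ _)) (suc i) = p ∷ All-removeAt ps i

    closed′ : ∀ {k} (ls : Vec (Line Box) k) →
              All (λ l → ends l ⊆ boxes) ls →
              (∀ i {b} → b ∈ ends (lookup ls i) → 1 ≤ degree remaining b) →
              All (λ l → ends l ⊆ filter alive? boxes) ls
    closed′ []       []       d = []
    closed′ (l ∷ ls) (c ∷ cs) d =
      (λ b∈l → ∈-filter⁺ alive? (c b∈l) (d zero b∈l)) ∷ closed′ ls cs (d ∘ suc)

  draw : Position n
  draw = record
    { Box      = Box
    ; _≟ᴮ_     = _≟ᴮ_
    ; boxes    = filter alive? boxes
    ; lines    = remaining
    ; unique   = Unique.filter⁺ alive? unique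
    ; closed   = closed′ remaining (All-removeAt closed m)
                   λ i {b} → count-positive (borders? b) remaining i
    ; degree≥1 = λ b∈ → proj₂ (∈-filter⁻ alive? {xs = boxes} b∈)
    ; degree≤4 = λ {b} b∈ → ≤-trans (count-removeAt-≤ (borders? b) lines m)
                   (degree≤4 (proj₁ (∈-filter⁻ alive? b∈)))
    }

-- A move claiming k boxes and leaving a position of value w; the turn passes
-- only when k = 0.
afterMove : ℕ → ℤ → ℤ
afterMove zero      w = ℤ.- w
afterMove k@(suc _) w = w ℤ.- ℤ.+ k

-- The net score of the player not to move, under optimal play.
v : ∀ {n} → Position n → ℤ
v {zero}  G = 0ℤ
v {suc n} G = foldr₁ ℤ._⊓_ (tabulate λ m → afterMove (claimed G m) (v (draw G m)))

infixr 6 _⊕_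

_⊕_ : ∀ {m n} → Position m → Position n → Position (m + n)
_⊕_ {m} {n} G H = record
  { Box      = Box
  ; _≟ᴮ_     = _≟ᴮ_
  ; boxes    = boxes
  ; lines    = linesG ++ linesH
  ; unique   = Unique.++⁺ (Unique.map⁺ inj₁-injective G.unique)
                 (Unique.map⁺ inj₂-injective H.unique) disjoint
  ; closed   = All.++⁺ (allˡ G.closed) (allʳ H.closed)
  ; degree≥1 = λ b∈ → bound (1 ≤_) G.degree≥1 H.degree≥1 (∈-++⁻ (List.map inj₁ G.boxes) b∈)
  ; degree≤4 = λ b∈ → bound (_≤ 4) G.degree≤4 H.degree≤4 (∈-++⁻ (List.map inj₁ G.boxes) b∈)
  }
  where
  module G = Position G
  module H = Position H
  Box = G.Box ⊎ H.Box
  _≟ᴮ_ : DecidableEquality Box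
  _≟ᴮ_ = ⊎-≟ G._≟ᴮ_ H._≟ᴮ_
  open Degree _≟ᴮ_
  boxes  = List.map inj₁ G.boxes List.++ List.map inj₂ H.boxes
  linesG = Vec.map (mapLine inj₁ inj₁-injective) G.lines
  linesH = Vec.map (mapLine inj₂ inj₂-injective) H.lines

  disjoint : ∀ {x} → ¬ (x ∈ List.map inj₁ G.boxes × x ∈ List.map inj₂ H.boxes)
  disjoint (p , q) with ∈-map⁻ inj₁ p | ∈-map⁻ inj₂ q
  ... | _ , _ , refl | _ , _ , ()

  to : ∀ {B C : Set} (f : B → C) (inj : Injective _≡_ _≡_ f) l {b} → b ∈ ends l → f b ∈ ends (mapLine f inj l)
  to f inj (one _)     (here refl)         = here refl
  to f inj (two _ _ _) (here refl)         = here refl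
  to f inj (two _ _ _) (there (here refl)) = there (here refl)

  from : ∀ {B C : Set} (f : B → C) (inj : Injective _≡_ _≡_ f) l {x} → x ∈ ends (mapLine f inj l) →
         x ∈ List.map f (ends l)
  from f inj (one _)     p = p
  from f inj (two _ _ _) p = p

  closedˡ : ∀ l → ends l ⊆ G.boxes → ends (mapLine inj₁ inj₁-injective l) ⊆ boxes
  closedˡ l c p with ∈-map⁻ inj₁ (from inj₁ inj₁-injective l p)
  ... | _ , b∈ , refl = ∈-++⁺ˡ (∈-map⁺ inj₁ (c b∈))

  closedʳ : ∀ l → ends l ⊆ H.boxes → ends (mapLine inj₂ inj₂-injective l) ⊆ boxes
  closedʳ l c p with ∈-map⁻ inj₂ (from inj₂ inj₂-injective l p)
  ... | _ , b∈ , refl = ∈-++⁺ʳ _ (∈-map⁺ inj₂ (c b∈))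

  allˡ : ∀ {k} {ls : Vec (Line G.Box) k} → All (λ l → ends l ⊆ G.boxes) ls →
         All (λ l → ends l ⊆ boxes) (Vec.map (mapLine inj₁ inj₁-injective) ls)
  allˡ []                   = []
  allˡ (_∷_ {x = l} l⊆ ls⊆) = (λ {_} → closedˡ l l⊆) ∷ allˡ ls⊆

  allʳ : ∀ {k} {ls : Vec (Line H.Box) k} → All (λ l → ends l ⊆ H.boxes) ls →
         All (λ l → ends l ⊆ boxes) (Vec.map (mapLine inj₂ inj₂-injective) ls)
  allʳ []                   = []
  allʳ (_∷_ {x = l} l⊆ ls⊆) = (λ {_} → closedʳ l l⊆) ∷ allʳ ls⊆

  back₁ : ∀ l {b} → inj₁ b ∈ ends (mapLine inj₁ inj₁-injective l) → b ∈ ends l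
  back₁ l p with ∈-map⁻ inj₁ (from inj₁ inj₁-injective l p)
  ... | _ , b∈ , refl = b∈

  back₂ : ∀ l {b} → inj₂ b ∈ ends (mapLine inj₂ inj₂-injective l) → b ∈ ends l
  back₂ l p with ∈-map⁻ inj₂ (from inj₂ inj₂-injective l p)
  ... | _ , b∈ , refl = b∈

  foreign₁ : ∀ l {b} → ¬ (inj₁ b ∈ ends (mapLine inj₂ inj₂-injective l))
  foreign₁ l p with ∈-map⁻ inj₂ (from inj₂ inj₂-injective l p)
  ... | _ , _ , ()

  foreign₂ : ∀ l {b} → ¬ (inj₂ b ∈ ends (mapLine inj₁ inj₁-injective l))
  foreign₂ l p with ∈-map⁻ inj₁ (from inj₁ inj₁-injective l p)
  ... | _ , _ , ()

  degree₁ : ∀ b → degree (linesG ++ linesH) (inj₁ b) ≡ G.degree G.lines b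
  degree₁ b = trans (count-++ (borders? (inj₁ b)) linesG linesH) (trans
    (cong₂ _+_
      (count-map (G.borders? b) (borders? (inj₁ b)) (mapLine inj₁ inj₁-injective)
        (λ l → to inj₁ inj₁-injective l) (λ l → back₁ l) G.lines)
      (count-zero (borders? (inj₁ b)) linesH (All.map⁺ (All.universal (λ l → foreign₁ l) H.lines))))
    (+-identityʳ _))

  degree₂ : ∀ b → degree (linesG ++ linesH) (inj₂ b) ≡ H.degree H.lines b
  degree₂ b = trans (count-++ (borders? (inj₂ b)) linesG linesH)
    (cong₂ _+_
      (count-zero (borders? (inj₂ b)) linesG (All.map⁺ (All.universal (λ l → foreign₂ l) G.lines)))
      (count-map (H.borders? b) (borders? (inj₂ b)) (mapLine inj₂ inj₂-injective)
        (λ l → to inj₂ inj₂-injective l) (λ l → back₂ l) H.lines))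

  bound : (P : ℕ → Set) →
          (∀ {b} → b ∈ G.boxes → P (G.degree G.lines b)) →
          (∀ {b} → b ∈ H.boxes → P (H.degree H.lines b)) →
          ∀ {x} → x ∈ List.map inj₁ G.boxes ⊎ x ∈ List.map inj₂ H.boxes →
          P (degree (linesG ++ linesH) x)
  bound P g h (inj₁ p) with ∈-map⁻ inj₁ p
  ... | b , b∈ , refl = subst P (sym (degree₁ b)) (g b∈)
  bound P g h (inj₂ p) with ∈-map⁻ inj₂ p
  ... | b , b∈ , refl = subst P (sym (degree₂ b)) (h b∈)

chainLines : ℕ → ℕ
chainLines zero    = 0
chainLines (suc k) = suc (suc k)

-- Chains have positive length; chain 0 is a dummy value.  In chain (suc k)
-- the box bᵢ is the element i - 1 of Fin (suc k), and the lines are listed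
-- in the order e₀ , … , eₖ₊₁.
chain : ∀ n → Position (chainLines n)
chain zero    = ∅
chain (suc k) = record
  { Box      = Fin (suc k)
  ; _≟ᴮ_     = _≟ᶠ_
  ; boxes    = allFin (suc k)
  ; lines    = one zero ∷ (tabulate inner ∷ʳ one (fromℕ k))
  ; unique   = Unique.allFin⁺ (suc k)
  ; closed   = All.universal (λ _ {b} _ → ∈-allFin b) _
  ; degree≥1 = λ {b} _ → lower b
  ; degree≤4 = λ {b} _ → upper b
  }
  where
  open Degree (_≟ᶠ_ {suc k})

  inject₁≢suc : ∀ {j} (i : Fin j) → inject₁ i ≢ suc i
  inject₁≢suc zero    ()
  inject₁≢suc (suc i) eq = inject₁≢suc i (suc-injective eq)

  inner : Fin k → Line (Fin (suc k))
  inner i = two (inject₁ i) (suc i) (inject₁≢suc i)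

  end : Line (Fin (suc k))
  end = one (fromℕ k)

  lower : ∀ b → 1 ≤ degree (one zero ∷ (tabulate inner ∷ʳ end)) b
  lower zero    = s≤s z≤n
  lower (suc i) = ≤-trans
    (count-positive (borders? (suc i)) (tabulate inner) i
      (subst (λ l → suc i ∈ ends l) (sym (lookup∘tabulate inner i)) (there (here refl))))
    (≤-trans (count-∷ʳ-≥ (borders? (suc i)) (tabulate inner) end)
             (count-∷-≥ (borders? (suc i)) (one zero) (tabulate inner ∷ʳ end)))

  upper : ∀ b → degree (one zero ∷ (tabulate inner ∷ʳ end)) b ≤ 4
  upper b = ≤-trans (count-∷-≤ (borders? b) (one zero) (tabulate inner ∷ʳ end)) (s≤s
    (≤-trans (count-∷ʳ-≤ (borders? b) (tabulate inner) end) (s≤s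
      (≤-trans
        (count-tabulate-∪ (borders? b) (b ≟ᶠ_) (b ≟ᶠ_) inner inject₁ suc cover)
        (+-mono-≤
          (count-tabulate-≤1 (b ≟ᶠ_) inject₁ λ i j p q → inject₁-injective (trans (sym p) q))
          (count-tabulate-≤1 (b ≟ᶠ_) suc λ i j p q → suc-injective (trans (sym p) q)))))))
    where
    cover : ∀ i → b ∈ ends (inner i) → b ≡ inject₁ i ⊎ b ≡ suc i
    cover i (here p)         = inj₁ p
    cover i (there (here p)) = inj₂ p

chains : (cs : List ℕ) → Position (sum (List.map chainLines cs))
chains []       = ∅
chains (c ∷ cs) = chain c ⊕ chains cs

-- Controlled value of chains cs, for cs non-empty with all entries ≥ 3.
cv : List ℕ → ℤ
cv cs = ℤ.+ 4 ℤ.+ List.foldr ℤ._+_ 0ℤ (List.map (λ c → ℤ.+ c ℤ.- ℤ.+ 4) cs)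

{-# OPTIONS --safe #-}
module Submission where

-- Let V be the value of a union of chains and W its value without the chain c.
-- Once c has been opened, the opponent can take all its boxes, for a net score
-- of c - W, or take all but two and give those away by a double deal, for
-- c - 4 + W; as all other chains are unopened, nothing does better.  Hence V is
-- the minimum over the chains c of max (c - W) (c - 4 + W).  By induction on the
-- number of chains, V exceeds the controlled value by an even number 2q with
-- V ≥ 1, and q = 0 unless V ≤ 2; this last bound comes from opening a 3-chain,
-- if there is one.

open import Defs
open import Data.Bool.Base using (Bool; true; false; _∨_; if_then_else_)
open import Data.Fin.Base using (Fin; zero; suc; inject₁; fromℕ)
open import Data.Integer.Base as ℤ using (ℤ; +_; _+_; -_; _-_; _≤_; 0ℤ; +≤+)
open import Data.Integer.Divisibility using (_∣_)
import Data.Integer.Properties as ℤ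
open import Data.Integer.Tactic.RingSolver using (solve-∀)
open import Data.List.Base as List using (List; []; _∷_; length; map; replicate; filter; _++_)
open import Data.List.Membership.Propositional using (_∈_)
open import Data.List.Membership.Propositional.Properties
  using (∈-map⁺; ∈-map⁻; ∈-++⁺ˡ; ∈-++⁺ʳ; ∈-++⁻)
open import Data.List.Membership.Propositional.Properties.WithK using (unique∧set⇒bag)
open import Data.List.Properties using (++-identityʳ; map-++; map-tabulate)
open import Data.List.Relation.Binary.BagAndSetEquality using (∼bag⇒↭)
open import Data.List.Relation.Binary.Permutation.Propositional as ↭ using (_↭_; ↭-refl; ↭-sym)
open import Data.List.Relation.Binary.Permutation.Propositional.Properties
  using (map⁺; All-resp-↭; ↭-length; ↭-singleton-inv)
open import Data.List.Relation.Binary.Subset.Propositional using (_⊆_)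
open import Data.List.Relation.Unary.All as All using (All; []; _∷_)
open import Data.List.Relation.Unary.AllPairs using ([]; _∷_)
open import Data.List.Relation.Unary.Any using (here; there)
open import Data.List.Relation.Unary.Unique.Propositional using (Unique)
open import Data.Nat.Base as ℕ using (ℕ; zero; suc; _∸_; _<_; z≤n; s≤s)
open import Data.Nat.Divisibility using (divides)
open import Data.Nat.ListAction using (sum)
open import Data.Nat.ListAction.Properties using (sum-↭)
import Data.Nat.Properties as ℕ
open import Data.Product.Base using (∃; ∃₂; _×_; _,_; proj₁; proj₂)
open import Data.Sum.Base as Sum using (_⊎_; inj₁; inj₂)
open import Data.Vec.Base as Vec using (Vec; []; _∷_; _∷ʳ_; count; foldr₁; removeAt; tabulate)
import Data.Vec.Relation.Unary.All as Vecᴬ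
open import Data.Vec.Relation.Unary.Any using (Any; here; there)
open import Function.Base using (const; id; _∘_)
open import Function.Bundles using (mk⇔)
open import Function.Definitions using (Injective)
open import Level using (0ℓ)
open import Relation.Binary.PropositionalEquality
open import Relation.Nullary using (¬_; contradiction; yes; no)
open import Relation.Unary using (Pred; Decidable)

-- The constant 4 counts the two boxes of the double deal twice, since the controller forgoes them
-- and the opponent gets them. The two offers c - W and c - 4 + W have sum 2c - 4, which is at least
-- 2 for c at least 3 whatever W is, so the larger is positive. Their difference is 4 - 2W, so for
-- positive W taking everything is strictly better only at W = 1, and then by exactly 2; hence the
-- parity. The two halves of the formula need unequal work. For a lower bound on V the chain may be
-- cut anywhere, but two explicit replies suffice. For an upper bound every reply must be
-- considered, but the opening may be chosen: an end line, after which captures keep the chain in a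
-- single shape. Captures are followed through the value plus the number of unclaimed boxes, which
-- no capture decreases. Since `draw` changes the list of boxes and the invariants of a `Position`,
-- play is analysed on lists of booleans and transferred to positions at the end.

private
  variable
    A : Set

-- Linear arithmetic in one step: the hypotheses are added up to one inequality, and the ring solver
-- checks that its sides differ by as much as those of the goal.
shift-≤ : ∀ {i j k l} → i ≤ j → j - i ≡ l - k → k ≤ l
shift-≤ i≤j eq = ℤ.0≤i-j⇒j≤i (subst (0ℤ ≤_) eq (ℤ.i≤j⇒0≤j-i i≤j))

-- Changing one entry of a list: a line in a row, or a row in a state

data One (R : A → A → Set) : List A → List A → Set where
  here  : ∀ {x y xs} → R x y → One R (x ∷ xs) (y ∷ xs)
  there : ∀ {x xs ys} → One R xs ys → One R (x ∷ xs) (x ∷ ys)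

ones : (A → List A) → List A → List (List A)
ones f []       = []
ones f (x ∷ xs) = map (_∷ xs) (f x) ++ map (x ∷_) (ones f xs)

module _ {R : A → A → Set} where

  one-sum : ∀ {w : A → ℕ} → (∀ {x y} → R x y → w x ≡ suc (w y)) →
            ∀ {xs ys} → One R xs ys → sum (map w xs) ≡ suc (sum (map w ys))
  one-sum {w} drop {ys = _ ∷ ys} (here r) = cong (ℕ._+ sum (map w ys)) (drop r)
  one-sum {w} drop (there {x} r) = trans (cong (w x ℕ.+_) (one-sum drop r)) (ℕ.+-suc _ _)

  one-sum-≤ : ∀ {w : A → ℕ} → (∀ {x y} → R x y → w y ℕ.≤ w x) →
              ∀ {xs ys} → One R xs ys → sum (map w ys) ℕ.≤ sum (map w xs)
  one-sum-≤ mono (here r)  = ℕ.+-monoˡ-≤ _ (mono r)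
  one-sum-≤ {w} mono (there {x} r) = ℕ.+-monoʳ-≤ (w x) (one-sum-≤ mono r)

  one-↭ : ∀ {xs ys xs′} → xs ↭ ys → One R xs xs′ → ∃ λ ys′ → One R ys ys′ × xs′ ↭ ys′
  one-↭ ↭.refl r = _ , r , ↭-refl
  one-↭ (↭.prep x p) (here r)  = _ , here r , ↭.prep _ p
  one-↭ (↭.prep x p) (there r) with _ , r′ , p′ ← one-↭ p r = _ , there r′ , ↭.prep x p′
  one-↭ (↭.swap x y p) (here r)          = _ , there (here r) , ↭.swap _ _ p
  one-↭ (↭.swap x y p) (there (here r))  = _ , here r , ↭.swap _ _ p
  one-↭ (↭.swap x y p) (there (there r)) with _ , r′ , p′ ← one-↭ p r =
    _ , there (there r′) , ↭.swap x y p′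
  one-↭ (↭.trans p q) r with _ , r′ , p′ ← one-↭ p r with _ , r″ , q′ ← one-↭ q r′ =
    _ , r″ , ↭.trans p′ q′

  module _ {f : A → List A} where

    ones-sound : (∀ {x y} → y ∈ f x → R x y) → ∀ xs {ys} → ys ∈ ones f xs → One R xs ys
    ones-sound sound (x ∷ xs) p with ∈-++⁻ (map (_∷ xs) (f x)) p
    ... | inj₁ q with _ , r , refl ← ∈-map⁻ (_∷ xs) q = here (sound r)
    ... | inj₂ q with _ , r , refl ← ∈-map⁻ (x ∷_) q  = there (ones-sound sound xs r)

    ones-complete : (∀ {x y} → R x y → y ∈ f x) → ∀ {xs ys} → One R xs ys → ys ∈ ones f xs
    ones-complete complete (here r) = ∈-++⁺ˡ (∈-map⁺ (_∷ _) (complete r))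
    ones-complete complete (there {x} {xs} r) =
      ∈-++⁺ʳ (map (_∷ xs) (f x)) (∈-map⁺ (x ∷_) (ones-complete complete r))

  one-exists : ∀ {w : A → ℕ} → (∀ x → 0 < w x → ∃ (R x)) →
               ∀ xs → 0 < sum (map w xs) → ∃ (One R xs)
  one-exists {w} ex (x ∷ xs) pos with w x in eq
  ... | suc _ = _ , here (proj₂ (ex x (subst (0 <_) (sym eq) ℕ.z<s)))
  ... | zero  = _ , there (proj₂ (one-exists ex xs pos))

-- Rows of booleans and their moves

-- A row holds the lines e₀ , … , eₙ of an n-chain in order, true for undrawn.
-- Its boxes lie between consecutive entries, and a box is claimed once both
-- its entries are false.

Row State : Set
Row   = List Bool
State = List Row

data Strike : Bool → Bool → Set where
  strike : Strike true false

Flip : Row → Row → Set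
Flip = One Strike

Draw : State → State → Set
Draw = One Flip

bit : Bool → ℕ
bit true  = 1
bit false = 0

undrawnʳ : Row → ℕ
undrawnʳ = sum ∘ map bit

undrawn : State → ℕ
undrawn = sum ∘ map undrawnʳ

unclaimedʳ : Row → ℕ
unclaimedʳ (b ∷ x@(c ∷ _)) = bit (b ∨ c) ℕ.+ unclaimedʳ x
unclaimedʳ _               = 0

unclaimed : State → ℕ
unclaimed = sum ∘ map unclaimedʳ

bit-strike : ∀ {b c} → Strike b c → bit b ≡ suc (bit c)
bit-strike strike = refl

flip-undrawn : ∀ {x y} → Flip x y → undrawnʳ x ≡ suc (undrawnʳ y)
flip-undrawn = one-sum bit-strike

draw-undrawn : ∀ {s t} → Draw s t → undrawn s ≡ suc (undrawn t)
draw-undrawn = one-sum flip-undrawn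

bit≤1 : ∀ b → bit b ℕ.≤ 1
bit≤1 true  = s≤s z≤n
bit≤1 false = z≤n

bit-∨-mono : ∀ b → bit (b ∨ false) ℕ.≤ bit (b ∨ true)
bit-∨-mono true  = s≤s z≤n
bit-∨-mono false = z≤n

flip-unclaimed : ∀ {x y} → Flip x y → unclaimedʳ y ℕ.≤ unclaimedʳ x
flip-unclaimed {_ ∷ []}    (here strike) = z≤n
flip-unclaimed {_ ∷ c ∷ _} (here strike) = ℕ.+-monoˡ-≤ _ (bit≤1 c)
flip-unclaimed (there {b} f@(here strike)) = ℕ.+-mono-≤ (bit-∨-mono b) (flip-unclaimed f)
flip-unclaimed {_ ∷ c ∷ _} (there {b} f@(there _)) = ℕ.+-monoʳ-≤ (bit (b ∨ c)) (flip-unclaimed f)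

draw-unclaimed : ∀ {s t} → Draw s t → unclaimed t ℕ.≤ unclaimed s
draw-unclaimed = one-sum-≤ flip-unclaimed

-- The value of a state and its optimal moves

best : List ℤ → ℤ
best []           = 0ℤ
best (i ∷ [])     = i
best (i ∷ j ∷ is) = i ℤ.⊓ best (j ∷ is)

best-≤ : ∀ {is i} → i ∈ is → best is ≤ i
best-≤ {i ∷ []}     (here refl) = ℤ.≤-refl
best-≤ {i ∷ j ∷ is} (here refl) = ℤ.i⊓j≤i i (best (j ∷ is))
best-≤ {i ∷ j ∷ is} (there p)   = ℤ.≤-trans (ℤ.i⊓j≤j i (best (j ∷ is))) (best-≤ p)

best-∈ : ∀ i is → best (i ∷ is) ∈ i ∷ is
best-∈ i []       = here refl
best-∈ i (j ∷ is) with ℤ.⊓-sel i (best (j ∷ is))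
... | inj₁ eq = here eq
... | inj₂ eq = there (subst (_∈ j ∷ is) (sym eq) (best-∈ j is))

strikes : Bool → List Bool
strikes true  = false ∷ []
strikes false = []

draws : State → List State
draws = ones (ones strikes)

draws-sound : ∀ s {t} → t ∈ draws s → Draw s t
draws-sound = ones-sound λ {x} → ones-sound (λ { {true} (here refl) → strike }) x

draws-complete : ∀ {s t} → Draw s t → t ∈ draws s
draws-complete = ones-complete (ones-complete λ { strike → here refl })

draw-exists : ∀ s → 0 < undrawn s → ∃ (Draw s)
draw-exists = one-exists (one-exists λ { true _ → false , strike })

-- The first argument is fuel, meant to be the number of undrawn lines.
val : ℕ → State → ℤ
val zero    s = 0ℤ
val (suc n) s = best (map (λ t → afterMove (unclaimed s ∸ unclaimed t) (val n t)) (draws s))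

value : State → ℤ
value s = val (undrawn s) s

value-≤ : ∀ {s t} → Draw s t → value s ≤ afterMove (unclaimed s ∸ unclaimed t) (value t)
value-≤ {s} {t} d rewrite draw-undrawn d = best-≤ (∈-map⁺ _ (draws-complete d))

value-attained : ∀ s → 0 < undrawn s →
  ∃ λ t → Draw s t × value s ≡ afterMove (unclaimed s ∸ unclaimed t) (value t)
value-attained s pos with t₁ , d₁ ← draw-exists s pos with undrawn s in eq
value-attained s (s≤s z≤n) | suc n with draws s in eqs
... | [] with () ← subst (t₁ ∈_) eqs (draws-complete d₁)
... | t₀ ∷ ts
  with t , t∈ , eqv ← ∈-map⁻ (λ t → afterMove (unclaimed s ∸ unclaimed t) (val n t))
                        {xs = t₀ ∷ ts} (best-∈ _ _)
  with d ← draws-sound s (subst (t ∈_) (sym eqs) t∈)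
  = t , d , subst (λ k → _ ≡ afterMove (unclaimed s ∸ unclaimed t) (val k t))
              (ℕ.suc-injective (trans (sym eq) (draw-undrawn d))) eqv

-- Adding the unclaimed boxes on both sides absorbs the score of a capture, so that successive
-- captures compose by transitivity.
afterMove-claim : ∀ {m n} w → n < m → afterMove (m ∸ n) w + + m ≡ w + + n
afterMove-claim {m} {n} w n<m with m ∸ n in eq
... | zero  = contradiction (ℕ.m∸n≡0⇒m≤n eq) (ℕ.<⇒≱ n<m)
... | suc k = trans (cong (λ i → w - + suc k + + i) m≡) (regroup w (+ suc k) (+ n))
  where
  m≡ : m ≡ suc k ℕ.+ n
  m≡ = sym (trans (cong (ℕ._+ n) (sym eq)) (ℕ.m∸n+n≡m (ℕ.<⇒≤ n<m)))
  regroup : ∀ w k n → w - k + (k + n) ≡ w + n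
  regroup = solve-∀

afterMove-pass : ∀ {m n} w → m ≡ n → afterMove (n ∸ m) w ≡ - w
afterMove-pass {m} w refl = cong (λ k → afterMove k w) (ℕ.n∸n≡0 m)

claim-≤ : ∀ {s t} → Draw s t → unclaimed t < unclaimed s →
          value s + + unclaimed s ≤ value t + + unclaimed t
claim-≤ {s} d less =
  ℤ.≤-trans (ℤ.+-monoˡ-≤ (+ unclaimed s) (value-≤ d)) (ℤ.≤-reflexive (afterMove-claim _ less))

pass-≤ : ∀ {s t} → Draw s t → unclaimed t ≡ unclaimed s → value s ≤ - value t
pass-≤ {s} {t} d same = subst (value s ≤_) (afterMove-pass (value t) same) (value-≤ d)

data Outcome (s t : State) : Set where
  claim : unclaimed t < unclaimed s → value s + + unclaimed s ≡ value t + + unclaimed t → Outcome s t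
  pass  : unclaimed t ≡ unclaimed s → value s ≡ - value t → Outcome s t

best-move : ∀ s → 0 < undrawn s → ∃ λ t → Draw s t × Outcome s t
best-move s pos with t , d , eq ← value-attained s pos with ℕ.m≤n⇒m<n∨m≡n (draw-unclaimed d)
... | inj₁ less = t , d , claim less (trans (cong (_+ + unclaimed s) eq) (afterMove-claim _ less))
... | inj₂ same = t , d , pass same (trans eq (afterMove-pass (value t) same))

-- Bisimilar states have equal values

module Simulation (_∼_ : State → State → Set)
  (same-undrawn   : ∀ {s t} → s ∼ t → undrawn s ≡ undrawn t)
  (same-unclaimed : ∀ {s t} → s ∼ t → unclaimed s ≡ unclaimed t)
  (forth : ∀ {s t s′} → s ∼ t → Draw s s′ → ∃ λ t′ → Draw t t′ × s′ ∼ t′)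
  (back  : ∀ {s t t′} → s ∼ t → Draw t t′ → ∃ λ s′ → Draw s s′ × s′ ∼ t′)
  where

  same-value : ∀ {s t} → s ∼ t → value s ≡ value t
  same-value s∼t = go _ s∼t refl
    where
    go : ∀ n {s t} → s ∼ t → undrawn s ≡ n → value s ≡ value t
    go zero    s∼t eq rewrite trans (sym (same-undrawn s∼t)) eq | eq = refl
    go (suc n) {s} {t} s∼t eq = ℤ.≤-antisym s≤t t≤s
      where
      after : ∀ {s′ t′} → Draw s s′ → s′ ∼ t′ →
              afterMove (unclaimed s ∸ unclaimed s′) (value s′) ≡
              afterMove (unclaimed t ∸ unclaimed t′) (value t′)
      after d s′∼t′ = cong₂ afterMove
                        (cong₂ _∸_ (same-unclaimed s∼t) (same-unclaimed s′∼t′))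
                        (go n s′∼t′ (ℕ.suc-injective (trans (sym (draw-undrawn d)) eq)))
      pos : 0 < undrawn s
      pos = subst (0 <_) (sym eq) ℕ.z<s
      s≤t : value s ≤ value t
      s≤t with t′ , d , eqt ← value-attained t (subst (0 <_) (same-undrawn s∼t) pos)
          with s′ , d′ , s′∼t′ ← back s∼t d
          = subst (value s ≤_) (trans (after d′ s′∼t′) (sym eqt)) (value-≤ d′)
      t≤s : value t ≤ value s
      t≤s with s′ , d , eqs ← value-attained s pos
          with t′ , d′ , s′∼t′ ← forth s∼t d
          = subst (value t ≤_) (trans (sym (after d s′∼t′)) (sym eqs)) (value-≤ d′)

value-↭ : ∀ {s t} → s ↭ t → value s ≡ value t
value-↭ = Simulation.same-value _↭_ (sum-↭ ∘ map⁺ _) (sum-↭ ∘ map⁺ _) one-↭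
  (λ p d → let _ , d′ , p′ = one-↭ (↭-sym p) d in _ , d′ , ↭-sym p′)

Blank : Row → Set
Blank x = undrawnʳ x ≡ 0

blank-unclaimed : ∀ x → Blank x → unclaimedʳ x ≡ 0
blank-unclaimed []                  eq = refl
blank-unclaimed (_ ∷ [])            eq = refl
blank-unclaimed (false ∷ false ∷ x) eq = blank-unclaimed (false ∷ x) eq

data Insert : State → State → Set where
  insert : ∀ {x s} → Blank x → Insert (x ∷ s) s

-- A blank row offers neither a move nor a box, so deleting it is a bisimulation.
value-blank : ∀ x s → Blank x → value (x ∷ s) ≡ value s
value-blank x s blank = Simulation.same-value Insert
  (λ { {t = t} (insert eq) → cong (ℕ._+ undrawn t) eq })
  (λ { {x ∷ _} {t} (insert eq) → cong (ℕ._+ unclaimed t) (blank-unclaimed x eq) })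
  (λ { (insert eq) (here f)  → contradiction (trans (sym eq) (flip-undrawn f)) λ ()
     ; (insert eq) (there d) → _ , d , insert eq })
  (λ { (insert eq) d → _ , there d , insert eq })
  (insert {x} blank)

-- Sequences of captures

infix 4 _⇝_

data _⇝_ : Row → Row → Set where
  done : ∀ {x} → x ⇝ x
  step : ∀ {x y z} → Flip x y → unclaimedʳ y < unclaimedʳ x → y ⇝ z → x ⇝ z

⇝-trans : ∀ {x y z} → x ⇝ y → y ⇝ z → x ⇝ z
⇝-trans done            q = q
⇝-trans (step f less p) q = step f less (⇝-trans p q)

cons-less : ∀ b {x y} → Flip x y → unclaimedʳ y < unclaimedʳ x →
            unclaimedʳ (b ∷ y) < unclaimedʳ (b ∷ x)
cons-less b         (here strike) less = ℕ.+-mono-≤-< (bit-∨-mono b) less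
cons-less b {c ∷ _} (there _)     less = ℕ.+-monoʳ-< (bit (b ∨ c)) less

⇝-cons : ∀ b {x y} → x ⇝ y → b ∷ x ⇝ b ∷ y
⇝-cons b done            = done
⇝-cons b (step f less p) = step (there f) (cons-less b f less) (⇝-cons b p)

blank : Row → Row
blank = map (const false)

blank-undrawn : ∀ x → Blank (blank x)
blank-undrawn []      = refl
blank-undrawn (_ ∷ x) = blank-undrawn x

-- An undrawn line next to a drawn one closes the box between them, so a drawn line spreads to the
-- right by captures. The part `z` is spared for the double deal.
sweepʳ : ∀ x z → false ∷ x ++ z ⇝ false ∷ blank x ++ z
sweepʳ []          z = done
sweepʳ (false ∷ x) z = ⇝-cons false (sweepʳ x z)
sweepʳ (true ∷ x)  z =
  step (there (here strike)) (s≤s (flip-unclaimed {true ∷ x ++ z} (here strike)))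
    (⇝-cons false (sweepʳ x z))

sweep : ∀ {x} z → false ∈ x → x ++ z ⇝ blank x ++ z
sweep {_ ∷ x}     z (here refl) = sweepʳ x z
sweep {false ∷ x} z (there _)   = sweepʳ x z
-- The tail is blanked first; the head is then the last line of the box to its right.
sweep {true ∷ x@(_ ∷ _)} z (there p) =
  ⇝-trans (⇝-cons true (sweep z p)) (step (here strike) ℕ.≤-refl done)

sweep-all : ∀ {x} → false ∈ x → x ⇝ blank x
sweep-all {x} p = subst₂ _⇝_ (++-identityʳ x) (++-identityʳ (blank x)) (sweep [] p)

-- Moves seen from one row of a state

-- The boxes of the part that the move does not touch are cancelled.
module _ {x : Row} {s : State} where

  private
    row-cancel : ∀ v w m n k → w + (n + k) - (v + (m + k)) ≡ w + n - (v + m)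
    row-cancel = solve-∀

    rest-cancel : ∀ v w m n k → w + (k + n) - (v + (k + m)) ≡ w + n - (v + m)
    rest-cancel = solve-∀

    row : ∀ y → value (x ∷ s) + + unclaimed (x ∷ s) ≤ value (y ∷ s) + + unclaimed (y ∷ s) →
          value (x ∷ s) + + unclaimedʳ x ≤ value (y ∷ s) + + unclaimedʳ y
    row y p = shift-≤ p
      (row-cancel (value (x ∷ s)) (value (y ∷ s)) (+ unclaimedʳ x) (+ unclaimedʳ y) (+ unclaimed s))

    rest : ∀ t → value (x ∷ s) + + unclaimed (x ∷ s) ≤ value (x ∷ t) + + unclaimed (x ∷ t) →
           value (x ∷ s) + + unclaimed s ≤ value (x ∷ t) + + unclaimed t
    rest t p = shift-≤ p
      (rest-cancel (value (x ∷ s)) (value (x ∷ t)) (+ unclaimed s) (+ unclaimed t) (+ unclaimedʳ x))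

  flip-claim-≤ : ∀ {y} → Flip x y → unclaimedʳ y < unclaimedʳ x →
                 value (x ∷ s) + + unclaimedʳ x ≤ value (y ∷ s) + + unclaimedʳ y
  flip-claim-≤ {y} f less = row y (claim-≤ (here f) (ℕ.+-monoˡ-< (unclaimed s) less))

  flip-pass-≤ : ∀ {y} → Flip x y → unclaimedʳ y ≡ unclaimedʳ x → value (x ∷ s) ≤ - value (y ∷ s)
  flip-pass-≤ f same = pass-≤ (here f) (cong (ℕ._+ unclaimed s) same)

  data BestMove : Set where
    flip-claim : ∀ {y} → Flip x y → unclaimedʳ y < unclaimedʳ x →
                 value (y ∷ s) + + unclaimedʳ y ≤ value (x ∷ s) + + unclaimedʳ x → BestMove
    flip-pass  : ∀ {y} → Flip x y → unclaimedʳ y ≡ unclaimedʳ x →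
                 - value (y ∷ s) ≤ value (x ∷ s) → BestMove
    rest-claim : ∀ {t} → Draw s t → unclaimed t < unclaimed s →
                 value (x ∷ t) + + unclaimed t ≤ value (x ∷ s) + + unclaimed s → BestMove
    rest-pass  : ∀ {t} → Draw s t → unclaimed t ≡ unclaimed s →
                 - value (x ∷ t) ≤ value (x ∷ s) → BestMove

  bestMove : 0 < undrawnʳ x → BestMove
  bestMove pos with best-move (x ∷ s) (ℕ.≤-trans pos (ℕ.m≤m+n _ (undrawn s)))
  ... | _ , here {y = y} f , claim less eq = flip-claim f
    (ℕ.+-cancelʳ-< (unclaimed s) (unclaimedʳ y) (unclaimedʳ x) less)
    (shift-≤ (ℤ.≤-reflexive (sym eq))
       (row-cancel (value (y ∷ s)) (value (x ∷ s)) (+ unclaimedʳ y) (+ unclaimedʳ x) (+ unclaimed s)))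
  ... | _ , here {y = y} f , pass same eq = flip-pass f
    (ℕ.+-cancelʳ-≡ (unclaimed s) (unclaimedʳ y) (unclaimedʳ x) same) (ℤ.≤-reflexive (sym eq))
  ... | _ , there {ys = t} d , claim less eq = rest-claim d
    (ℕ.+-cancelˡ-< (unclaimedʳ x) (unclaimed t) (unclaimed s) less)
    (shift-≤ (ℤ.≤-reflexive (sym eq))
       (rest-cancel (value (x ∷ t)) (value (x ∷ s)) (+ unclaimed t) (+ unclaimed s) (+ unclaimedʳ x)))
  ... | _ , there {ys = t} d , pass same eq = rest-pass d
    (ℕ.+-cancelˡ-≡ (unclaimedʳ x) (unclaimed t) (unclaimed s) same) (ℤ.≤-reflexive (sym eq))

claims-≤ : ∀ {x y} s → x ⇝ y → value (x ∷ s) + + unclaimedʳ x ≤ value (y ∷ s) + + unclaimedʳ y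
claims-≤ s done            = ℤ.≤-refl
claims-≤ s (step f less p) = ℤ.≤-trans (flip-claim-≤ f less) (claims-≤ s p)

value-blank-+ : ∀ x s → Blank x → value (x ∷ s) + + unclaimedʳ x ≡ value s
value-blank-+ x s b =
  trans (cong₂ (λ v k → v + + k) (value-blank x s b) (blank-unclaimed x b)) (ℤ.+-identityʳ (value s))

-- The mover empties `x` by captures and still has the turn when only `s` is left.
takeAll : ∀ x s → false ∈ x → value (x ∷ s) + + unclaimedʳ x ≤ value s
takeAll x s p = subst (value (x ∷ s) + + unclaimedʳ x ≤_)
  (value-blank-+ (blank x) s (blank-undrawn x)) (claims-≤ s (sweep-all p))

-- Last lines of a row and the double deal

record Lone (x : Row) : Set where
  field
    gap    : false ∈ x
    single : undrawnʳ x ≡ 1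
    worth  : 0 < unclaimedʳ x

-- Delaying the capture never helps: after a move elsewhere that claims nothing
-- the opponent takes the boxes of x.
lone-≥ : ∀ x s → Lone x → value s ≤ value (x ∷ s) + + unclaimedʳ x
lone-≥ x s lone = go _ s refl
  where
  open Lone lone
  k = unclaimedʳ x
  after : ∀ {y} → Flip x y → Blank y
  after f = ℕ.suc-injective (trans (sym (flip-undrawn f)) single)
  go : ∀ n s → undrawn s ≡ n → value s ≤ value (x ∷ s) + + k
  go n s eq with bestMove {x} {s} (subst (0 <_) (sym single) ℕ.z<s)
  ... | flip-claim {y} f less v≥ = subst (_≤ value (x ∷ s) + + k) (value-blank-+ y s (after f)) v≥
  ... | flip-pass {y} f same v≥ =
    contradiction (trans (sym (blank-unclaimed y (after f))) same) (ℕ.<⇒≢ worth)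
  go zero    s eq | rest-claim d less v≥ = contradiction (trans (sym eq) (draw-undrawn d)) λ ()
  go zero    s eq | rest-pass  d same v≥ = contradiction (trans (sym eq) (draw-undrawn d)) λ ()
  go (suc n) s eq | rest-claim {t} d less v≥ = shift-≤
    (ℤ.+-mono-≤ (ℤ.+-mono-≤ (claim-≤ d less) v≥)
       (go n t (ℕ.suc-injective (trans (sym (draw-undrawn d)) eq))))
    (arith (value s) (value t) (value (x ∷ s)) (value (x ∷ t)) (+ k) (+ unclaimed s) (+ unclaimed t))
    where
    arith : ∀ v v′ w w′ k m n → v′ + n + (w + m) + (w′ + k) - (v + m + (w′ + n) + v′) ≡ w + k - v
    arith = solve-∀
  -- The pass loses the boxes of `x` instead of winning them, so the bound holds with `k + k` to
  -- spare.
  go (suc n) s eq | rest-pass {t} d same v≥ = shift-≤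
    (ℤ.+-mono-≤ (ℤ.+-mono-≤ (ℤ.+-mono-≤ (pass-≤ d same) v≥) (takeAll x t gap))
       (+≤+ (z≤n {k ℕ.+ k})))
    (arith (value s) (value t) (value (x ∷ s)) (value (x ∷ t)) (+ k))
    where
    arith : ∀ v v′ w w′ k → - v′ + w + v′ + (k + k) - (v + - w′ + (w′ + k) + 0ℤ) ≡ w + k - v
    arith = solve-∀

-- The controller's sacrifice: y is reached by captures, and the move from y
-- to z gives away the last two boxes in one piece.
record DoubleDeal (x : Row) : Set where
  field
    {y z}    : Row
    captures : x ⇝ y
    deal     : Flip y z
    two-y    : unclaimedʳ y ≡ 2
    two-z    : unclaimedʳ z ≡ 2
    lone     : Lone z

-- After the deal the opponent can do no better than to take both boxes with the one line left in
-- `z`, and must then move in `s`. Relative to taking everything, the two boxes count twice.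
doubleDeal-≤ : ∀ {x} s → DoubleDeal x → value (x ∷ s) + + unclaimedʳ x + value s ≤ + 4
doubleDeal-≤ {x} s dd = shift-≤
  (ℤ.+-mono-≤ (ℤ.+-mono-≤
     (subst (λ k → value (x ∷ s) + + unclaimedʳ x ≤ value (y ∷ s) + + k) two-y (claims-≤ s captures))
     (flip-pass-≤ deal (trans two-z (sym two-y))))
     (subst (λ k → value s ≤ value (z ∷ s) + + k) two-z (lone-≥ z s lone)))
  (arith (value (x ∷ s)) (value (y ∷ s)) (value (z ∷ s)) (value s) (+ unclaimedʳ x))
  where
  open DoubleDeal dd
  arith : ∀ v w u r k → w + + 2 + - u + (u + + 2) - (v + k + w + r) ≡ + 4 - (v + k + r)
  arith = solve-∀

∈-blank : ∀ {x} → false ∈ x → false ∈ blank x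
∈-blank = ∈-map⁺ (const false)

module _ {w : Row} (gap : false ∈ w) where

  private
    lineʳ : ∀ w z → undrawnʳ (blank w ++ z) ≡ undrawnʳ z
    lineʳ []      z = refl
    lineʳ (_ ∷ w) z = lineʳ w z

    boxesʳ : ∀ b w → unclaimedʳ (false ∷ blank w ++ true ∷ b ∷ []) ≡ 2
    boxesʳ b []      = refl
    boxesʳ b (_ ∷ w) = boxesʳ b w

    deal : ∀ w → Flip (blank w ++ true ∷ true ∷ []) (blank w ++ true ∷ false ∷ [])
    deal []      = there (here strike)
    deal (_ ∷ w) = there (deal w)

    twoʳ : ∀ b {w} → false ∈ w → unclaimedʳ (blank w ++ true ∷ b ∷ []) ≡ 2
    twoʳ b {_ ∷ w} _ = boxesʳ b w

    twoˡ : ∀ b {w} → false ∈ w → unclaimedʳ (b ∷ true ∷ blank w) ≡ 2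
    twoˡ true  {_ ∷ w} _ = cong (2 ℕ.+_) (blank-unclaimed (false ∷ blank w) (blank-undrawn w))
    twoˡ false {_ ∷ w} _ = cong (2 ℕ.+_) (blank-unclaimed (false ∷ blank w) (blank-undrawn w))

  -- Captures blank `w` and leave two boxes at the right end; striking the last line makes both
  -- depend on the single line between them.
  doubleDealʳ : DoubleDeal (w ++ true ∷ true ∷ [])
  doubleDealʳ = record
    { captures = sweep _ gap
    ; deal     = deal w
    ; two-y    = twoʳ true gap
    ; two-z    = twoʳ false gap
    ; lone     = record
      { gap    = ∈-++⁺ˡ (∈-blank gap)
      ; single = lineʳ w _
      ; worth  = subst (0 <_) (sym (twoʳ false gap)) ℕ.z<s
      }
    }

  doubleDealˡ : DoubleDeal (true ∷ true ∷ w)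
  doubleDealˡ = record
    { captures = ⇝-cons true (⇝-cons true (sweep-all gap))
    ; deal     = here strike
    ; two-y    = twoˡ true gap
    ; two-z    = twoˡ false gap
    ; lone     = record
      { gap    = here refl
      ; single = cong suc (blank-undrawn w)
      ; worth  = subst (0 <_) (sym (twoˡ false gap)) ℕ.z<s
      }
    }

flip-gap : ∀ {x y} → Flip x y → false ∈ y
flip-gap (here strike) = here refl
flip-gap (there f)     = there (flip-gap f)

-- Unopened chains

full : ℕ → Row
full c = replicate (suc c) true

full-unclaimed : ∀ c → unclaimedʳ (full c) ≡ c
full-unclaimed zero    = refl
full-unclaimed (suc c) = cong suc (full-unclaimed c)

-- The leading undrawn line makes the induction work: whether the box before a struck line survives
-- depends on the preceding entry.
flip-full-unclaimed′ : ∀ c {x} → Flip (full c) x → unclaimedʳ (true ∷ x) ≡ suc c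
flip-full-unclaimed′ zero    (here strike) = refl
flip-full-unclaimed′ (suc c) (here strike) = cong (2 ℕ.+_) (full-unclaimed c)
flip-full-unclaimed′ (suc c) (there f)     = cong suc (flip-full-unclaimed′ c f)

flip-full-unclaimed : ∀ c {x} → 1 ℕ.≤ c → Flip (full c) x → unclaimedʳ x ≡ c
flip-full-unclaimed (suc c) _ (here strike) = cong suc (full-unclaimed c)
flip-full-unclaimed (suc c) _ (there f)     = flip-full-unclaimed′ c f

replicate-∷ʳ² : ∀ n → replicate n true ++ true ∷ true ∷ [] ≡ replicate (2 ℕ.+ n) true
replicate-∷ʳ² zero    = refl
replicate-∷ʳ² (suc n) = cong (true ∷_) (replicate-∷ʳ² n)

-- A deal at one end needs the drawn line to lie outside the last two lines of that end. Length 3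
-- means four lines, so one of the ends qualifies: the right one if one of the first two lines was
-- struck, the left one otherwise.
flip-full-doubleDeal : ∀ {c x} → 3 ℕ.≤ c → Flip (full c) x → DoubleDeal x
flip-full-doubleDeal (s≤s (s≤s (s≤s (z≤n {c})))) (here strike) =
  subst (λ w → DoubleDeal (false ∷ w)) (replicate-∷ʳ² (suc c))
    (doubleDealʳ {false ∷ replicate (suc c) true} (here refl))
flip-full-doubleDeal (s≤s (s≤s (s≤s (z≤n {c})))) (there (here strike)) =
  subst (λ w → DoubleDeal (true ∷ false ∷ w)) (replicate-∷ʳ² c) (doubleDealʳ (there (here refl)))
flip-full-doubleDeal (s≤s (s≤s (s≤s z≤n))) (there (there f)) = doubleDealˡ (flip-gap f)

Quiet : State → Set
Quiet s = ∀ {t} → Draw s t → unclaimed t ≡ unclaimed s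

-- Chains opened at an end

hanging : ℕ → ℕ → Row
hanging j n = replicate (suc j) false ++ replicate n true

hanging-unclaimed : ∀ j n → unclaimedʳ (hanging j n) ≡ n
hanging-unclaimed (suc j) n = hanging-unclaimed j n
hanging-unclaimed zero zero = refl
hanging-unclaimed zero (suc n) = cong suc (full-unclaimed n)

hanging-undrawn : ∀ j n → undrawnʳ (hanging j n) ≡ n
hanging-undrawn (suc j) n = hanging-undrawn j n
hanging-undrawn zero zero = refl
hanging-undrawn zero (suc n) = cong suc (hanging-undrawn zero n)

-- Only the undrawn line nearest to the gap closes a box while two or more boxes are left, so
-- captures never leave the family `hanging`.
flip-hanging : ∀ j m {y} → Flip (hanging j (2 ℕ.+ m)) y →
               y ≡ hanging (suc j) (suc m) ⊎ unclaimedʳ y ≡ 2 ℕ.+ m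
flip-hanging zero    m (there (here strike)) = inj₁ refl
flip-hanging zero    m (there (there f))     = inj₂ (cong suc (flip-full-unclaimed′ m f))
flip-hanging (suc j) m (there (there f)) with flip-hanging j m (there f)
... | inj₁ refl = inj₁ refl
... | inj₂ eq   = inj₂ eq

-- A move that claims nothing, here or in s, lets the opponent take all n boxes
-- still there; this is worth it at most for n = 2, the double deal.
hanging-≥ : ∀ {s} → Quiet s → ∀ m j → let n = suc m in
  value s ≤ value (hanging j n ∷ s) + + n ⊎ + 4 ≤ value (hanging j n ∷ s) + + n + value s
hanging-≥ {s} quiet zero j = inj₁
  (subst (λ k → value s ≤ value (hanging j 1 ∷ s) + + k) (hanging-unclaimed j 1)
    (lone-≥ (hanging j 1) s record
      { gap    = here refl
      ; single = hanging-undrawn j 1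
      ; worth  = subst (0 <_) (sym (hanging-unclaimed j 1)) ℕ.z<s
      }))
hanging-≥ {s} quiet (suc m) j =
  from (bestMove {h} {s} (subst (0 <_) (sym (hanging-undrawn j n)) ℕ.z<s))
  where
  n = 2 ℕ.+ m
  h = hanging j n
  boxes-h : unclaimedʳ h ≡ n
  boxes-h = hanging-unclaimed j n
  arith₁ : ∀ v w r m → v + r + (m + m) - (- w + (w + (+ 2 + m)) + 0ℤ) ≡ v + (+ 2 + m) + r - + 4
  arith₁ = solve-∀
  arith₂ : ∀ v w r r′ n → v + - r′ + r′ + (n + n) - (- w + r + (w + n) + 0ℤ) ≡ v + n - r
  arith₂ = solve-∀
  from : BestMove {h} {s} → value s ≤ value (h ∷ s) + + n ⊎ + 4 ≤ value (h ∷ s) + + n + value s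
  from (flip-claim {y} f less v≥) with flip-hanging j m f
  ... | inj₂ eq   = contradiction (trans eq (sym boxes-h)) (ℕ.<⇒≢ less)
  ... | inj₁ refl = Sum.map (λ ih → ℤ.≤-trans ih v≥′)
                      (λ ih → ℤ.≤-trans ih (ℤ.+-monoˡ-≤ (value s) v≥′)) (hanging-≥ quiet m (suc j))
    where
    v≥′ : value (y ∷ s) + + suc m ≤ value (h ∷ s) + + n
    v≥′ = subst₂ (λ k l → value (y ∷ s) + + k ≤ value (h ∷ s) + + l)
            (hanging-unclaimed (suc j) (suc m)) boxes-h v≥
  -- The reply takes all `n` boxes, which bounds the right-hand side below by `n + n`, that is 4 +
  -- (m + m).
  from (flip-pass {y} f same v≥) = inj₂ (shift-≤
    (ℤ.+-mono-≤ (ℤ.+-mono-≤ v≥ take) (+≤+ (z≤n {m ℕ.+ m})))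
    (arith₁ (value (h ∷ s)) (value (y ∷ s)) (value s) (+ m)))
    where
    take : value (y ∷ s) + + n ≤ value s
    take = subst (λ k → value (y ∷ s) + + k ≤ value s) (trans same boxes-h) (takeAll y s (flip-gap f))
  from (rest-claim d less v≥) = contradiction (quiet d) (ℕ.<⇒≢ less)
  -- The same move is available in `s` alone; beside `h` it moreover hands over the `n` boxes of
  -- `h`.
  from (rest-pass {t} d same v≥) = inj₁ (shift-≤
    (ℤ.+-mono-≤ (ℤ.+-mono-≤ (ℤ.+-mono-≤ v≥ (pass-≤ d same)) take) (+≤+ (z≤n {n ℕ.+ n})))
    (arith₂ (value (h ∷ s)) (value (h ∷ t)) (value s) (value t) (+ n)))
    where
    take : value (h ∷ t) + + n ≤ value t
    take = subst (λ k → value (h ∷ t) + + k ≤ value t) boxes-h (takeAll h t (here refl))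

-- The two bounds for a union of unopened chains

fulls : List ℕ → State
fulls = map full

fulls-draw : ∀ cs {t} → Draw (fulls cs) t →
  ∃₂ λ c ds → ∃ λ x → cs ↭ c ∷ ds × Flip (full c) x × t ↭ x ∷ fulls ds
fulls-draw (c ∷ cs) (here f) = c , cs , _ , ↭-refl , f , ↭-refl
fulls-draw (c ∷ cs) (there d) with e , ds , x , p , f , q ← fulls-draw cs d =
  e , c ∷ ds , x , ↭.trans (↭.prep c p) (↭.swap c e ↭-refl) , f
    , ↭.trans (↭.prep (full c) q) (↭.swap (full c) x ↭-refl)

fulls-quiet : ∀ {cs} → All (1 ℕ.≤_) cs → Quiet (fulls cs)
fulls-quiet {c ∷ cs} (1≤c ∷ _)  (here f) = cong (ℕ._+ unclaimed (fulls cs))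
  (trans (flip-full-unclaimed c 1≤c f) (sym (full-unclaimed c)))
fulls-quiet {c ∷ cs} (_ ∷ 1≤cs) (there d) = cong (unclaimedʳ (full c) ℕ.+_) (fulls-quiet 1≤cs d)

3≤⇒1≤ : ∀ {c} → 3 ℕ.≤ c → 1 ℕ.≤ c
3≤⇒1≤ = ℕ.≤-trans (s≤s z≤n)

-- The value is a minimum, so any one opening bounds it. Striking the first line of `c` leads to
-- `hanging`, where all replies are under control.
fulls-≤ : ∀ {c cs} → 1 ℕ.≤ c → All (1 ℕ.≤_) cs →
  value (fulls (c ∷ cs)) + value (fulls cs) ≤ + c ⊎
  value (fulls (c ∷ cs)) + + 4 ≤ value (fulls cs) + + c
fulls-≤ {suc m} {cs} 1≤c 1≤cs = Sum.map
  (λ h≥ → shift-≤ (ℤ.+-mono-≤ V≤ h≥) (arith₁ V W R (+ suc m)))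
  (λ h≥ → shift-≤ (ℤ.+-mono-≤ V≤ h≥) (arith₂ V W R (+ suc m)))
  (hanging-≥ (fulls-quiet 1≤cs) m zero)
  where
  V = value (fulls (suc m ∷ cs))
  W = value (hanging 0 (suc m) ∷ fulls cs)
  R = value (fulls cs)
  opening : Draw (fulls (suc m ∷ cs)) (hanging 0 (suc m) ∷ fulls cs)
  opening = here (here strike)
  V≤ : V ≤ - W
  V≤ = pass-≤ opening (fulls-quiet (1≤c ∷ 1≤cs) opening)
  arith₁ : ∀ v w r k → - w + (w + k) - (v + r) ≡ k - (v + r)
  arith₁ = solve-∀
  arith₂ : ∀ v w r k → - w + (w + k + r) - (v + + 4) ≡ r + k - (v + + 4)
  arith₂ = solve-∀

-- `d` is the chain opened by an optimal move. Wherever it is cut, the opponent has both replies,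
-- taking everything and the double deal, and each yields one inequality.
fulls-≥ : ∀ c cs → All (3 ℕ.≤_) (c ∷ cs) → ∃₂ λ d ds → c ∷ cs ↭ d ∷ ds ×
  + d ≤ value (fulls (c ∷ cs)) + value (fulls ds) ×
  value (fulls ds) + + d ≤ value (fulls (c ∷ cs)) + + 4
fulls-≥ c cs 3≤ with best-move (fulls (c ∷ cs)) ℕ.z<s
... | t , m , claim less eq = contradiction (fulls-quiet (All.map 3≤⇒1≤ 3≤) m) (ℕ.<⇒≢ less)
... | t , m , pass same eq
  with d , ds , x , p , f , q ← fulls-draw (c ∷ cs) m
  with 3≤d ∷ _ ← All-resp-↭ p 3≤
  = d , ds , p
  , shift-≤ (ℤ.+-mono-≤ v≥ take) (arith₁ V W R (+ d))
  , shift-≤ (ℤ.+-mono-≤ v≥ deal) (arith₂ V W R (+ d))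
  where
  V = value (fulls (c ∷ cs))
  W = value (x ∷ fulls ds)
  R = value (fulls ds)
  v≥ : - W ≤ V
  v≥ = ℤ.≤-reflexive (sym (trans eq (cong -_ (value-↭ q))))
  boxes-x : unclaimedʳ x ≡ d
  boxes-x = flip-full-unclaimed d (3≤⇒1≤ 3≤d) f
  take : W + + d ≤ R
  take = subst (λ k → W + + k ≤ R) boxes-x (takeAll x (fulls ds) (flip-gap f))
  deal : W + + d + R ≤ + 4
  deal = subst (λ k → W + + k + R ≤ + 4) boxes-x
           (doubleDeal-≤ (fulls ds) (flip-full-doubleDeal 3≤d f))
  arith₁ : ∀ v w r k → v + r - (- w + (w + k)) ≡ v + r - k
  arith₁ = solve-∀
  arith₂ : ∀ v w r k → v + + 4 - (- w + (w + k + r)) ≡ v + + 4 - (r + k)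
  arith₂ = solve-∀

-- Positions as states

private
  variable
    B     : Set
    m n   : ℕ
    p r   : List B
    bs cs : List B
    ls ks : Vec (Line B) n
    b     : Bool
    x y   : Row
    s t   : State

data Cell {B : Set} (es : List B) : Bool → Vec (Line B) m → Vec (Line B) n → Set where
  off : Cell es false ls ls
  on  : ∀ {l} → ends l ≡ es → Cell es true ls (l ∷ ls)

data Border {B : Set} : List B → Row → List B → List B → Set where
  edge  : Border [] [] bs bs
  inner : ∀ {r} → Border (r ∷ []) (b ∷ x) bs (r ∷ bs)

-- Lines p s bs ls: the undrawn lines of s, row by row, are ls, where p holds
-- the box, if any, to the left of the first row and bs the other boxes.
data Lines {B : Set} : List B → State → List B → Vec (Line B) n → Set where
  none : Lines [] [] [] []
  next : Lines [] s bs ls → Lines [] ([] ∷ s) bs ls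
  cell : Border r x bs cs → Cell (p ++ r) b ls ks →
         Lines r (x ∷ s) bs ls → Lines p ((b ∷ x) ∷ s) cs ks

lines-undrawn : {ls : Vec (Line B) n} → Lines p s bs ls → undrawn s ≡ n
lines-undrawn none              = refl
lines-undrawn (next L)          = lines-undrawn L
lines-undrawn (cell _ off L)    = lines-undrawn L
lines-undrawn (cell _ (on _) L) = cong suc (lines-undrawn L)

-- The move is split only to show that the row to the right of the new cell stays non-empty, as
-- `inner` demands.
extend : Border r x bs cs → Draw (x ∷ s) t → Cell (p ++ r) b ls ks → Lines r t bs ls →
         ∃ λ u → Draw ((b ∷ x) ∷ s) u × Lines p u cs ks
extend B     (there d)        c L = _ , there d , cell B c L
extend inner (here (here σ))  c L = _ , here (there (here σ)) , cell inner c L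
extend inner (here (there f)) c L = _ , here (there (there f)) , cell inner c L

erase : {ls : Vec (Line B) (suc n)} → Lines p s bs ls → (i : Fin (suc n)) →
        ∃ λ t → Draw s t × Lines p t bs (removeAt ls i)
erase (next L) i with erase L i
... | _ , d , L′ = _ , there d , next L′
erase (cell B off L) i with _ , d , L′ ← erase L i = extend B d off L′
erase (cell B (on eq) L) zero = _ , here (here strike) , cell B off L
erase {ls = _ ∷ _ ∷ _} (cell B (on eq) L) (suc i) with _ , d , L′ ← erase L i =
  extend B d (on eq) L′

border-draw : Border r x bs cs → Draw (x ∷ s) (y ∷ t) → Border r y bs cs
border-draw B     (there _)        = B
border-draw inner (here (here _))  = inner
border-draw inner (here (there _)) = inner

mutual

  locate : {ls : Vec (Line B) (suc n)} → Lines p s bs ls → Draw s t →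
           ∃ λ i → Lines p t bs (removeAt ls i)
  locate (next L)           (there d) with i , L′ ← locate L d = i , next L′
  locate (cell B (on eq) L) (here (here strike)) = zero , cell B off L
  locate (cell B c L)       (here (there f))     = locate-tail B c L (here f)
  locate (cell B c L)       (there d)            = locate-tail B c L (there d)

  locate-tail : {ls : Vec (Line B) m} {ks : Vec (Line B) (suc n)} →
    Border r x bs cs → Cell (p ++ r) b ls ks → Lines r (x ∷ s) bs ls → Draw (x ∷ s) (y ∷ t) →
    ∃ λ i → Lines p ((b ∷ y) ∷ t) cs (removeAt ks i)
  locate-tail B off L d with i , L′ ← locate L d = i , cell (border-draw B d) off L′
  -- Without a further line there is no move to locate. In the other case the visible `_ ∷ _` lets
  -- `removeAt` reduce at `suc i`.
  locate-tail {ls = []}    B (on eq) L d with () ← trans (sym (draw-undrawn d)) (lines-undrawn L)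
  locate-tail {ls = _ ∷ _} B (on eq) L d with i , L′ ← locate L d =
    suc i , cell (border-draw B d) (on eq) L′

-- The unclaimed boxes as a list

head? : Row → Bool
head? []      = false
head? (b ∷ _) = b

first : State → Bool
first []      = false
first (x ∷ _) = head? x

unclaimedBoxes : Lines {B} {n} p s bs ls → List B
unclaimedBoxes none     = []
unclaimedBoxes (next L) = unclaimedBoxes L
unclaimedBoxes (cell {r = r} {x = x} {b = b} _ _ L) = (if b ∨ head? x then r else []) ++ unclaimedBoxes L

length-unclaimedBoxes : (L : Lines p s bs ls) → length (unclaimedBoxes L) ≡ unclaimed s
length-unclaimedBoxes none     = refl
length-unclaimedBoxes (next L) = length-unclaimedBoxes L
length-unclaimedBoxes (cell {b = true}  edge _ L) = length-unclaimedBoxes L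
length-unclaimedBoxes (cell {b = false} edge _ L) = length-unclaimedBoxes L
length-unclaimedBoxes (cell {b = true}                  inner _ L) = cong suc (length-unclaimedBoxes L)
length-unclaimedBoxes (cell {x = true ∷ _}  {b = false} inner _ L) = cong suc (length-unclaimedBoxes L)
length-unclaimedBoxes (cell {x = false ∷ _} {b = false} inner _ L) = length-unclaimedBoxes L

unclaimedBoxes-⊆ : (L : Lines p s bs ls) → unclaimedBoxes L ⊆ bs
unclaimedBoxes-⊆ (next L) q = unclaimedBoxes-⊆ L q
unclaimedBoxes-⊆ (cell {b = true}  edge _ L) q = unclaimedBoxes-⊆ L q
unclaimedBoxes-⊆ (cell {b = false} edge _ L) q = unclaimedBoxes-⊆ L q
unclaimedBoxes-⊆ (cell {x = x} {b = b} inner _ L) q with b ∨ head? x | q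
... | true  | here eq = here eq
... | true  | there q = there (unclaimedBoxes-⊆ L q)
... | false | q       = there (unclaimedBoxes-⊆ L q)

unclaimedBoxes-unique : (L : Lines p s bs ls) → Unique bs → Unique (unclaimedBoxes L)
unclaimedBoxes-unique none     u = []
unclaimedBoxes-unique (next L) u = unclaimedBoxes-unique L u
unclaimedBoxes-unique (cell {b = true}  edge _ L) u = unclaimedBoxes-unique L u
unclaimedBoxes-unique (cell {b = false} edge _ L) u = unclaimedBoxes-unique L u
unclaimedBoxes-unique (cell {x = x} {b = b} inner _ L) (∉ ∷ u) with b ∨ head? x
... | true  = All.tabulate (λ q → All.lookup ∉ (unclaimedBoxes-⊆ L q)) ∷ unclaimedBoxes-unique L u
... | false = unclaimedBoxes-unique L u

first-line : ∀ {q} → Lines p s bs ls → first s ≡ true → q ∈ p → Any (λ l → q ∈ ends l) ls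
first-line (cell _ (on eq) L) refl q = here (subst (_ ∈_) (sym eq) (∈-++⁺ˡ q))

unclaimedBoxes-sound : ∀ {q} (L : Lines p s bs ls) →
                       q ∈ unclaimedBoxes L → Any (λ l → q ∈ ends l) ls
unclaimedBoxes-sound (next L) q = unclaimedBoxes-sound L q
unclaimedBoxes-sound (cell {r = r} {x = x} {b = b} _ c L) q
  with ∈-++⁻ (if b ∨ head? x then r else []) q | c
... | inj₂ q | off  = unclaimedBoxes-sound L q
... | inj₂ q | on _ = there (unclaimedBoxes-sound L q)
... | inj₁ q | on eq = here (subst (_ ∈_) (sym eq) (∈-++⁺ʳ _ q))
... | inj₁ q | off with head? x in eq
...   | true = first-line L eq q

-- The box in `p` is the one exception: it is listed with the cell to its left, outside `L`. For a
-- whole position `p` is empty and the exception vanishes.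
unclaimedBoxes-complete : ∀ {q} (L : Lines p s bs ls) →
                          Any (λ l → q ∈ ends l) ls → q ∈ unclaimedBoxes L ⊎ first s ≡ true × q ∈ p
unclaimedBoxes-complete (next L) a = Sum.map₂ (λ ()) (Sum.map₂ proj₂ (unclaimedBoxes-complete L a))
unclaimedBoxes-complete {p = p} (cell _ (on eq) L) (here q) with ∈-++⁻ p (subst (_ ∈_) eq q)
... | inj₁ q∈p = inj₂ (refl , q∈p)
... | inj₂ q∈r = inj₁ (∈-++⁺ˡ q∈r)
unclaimedBoxes-complete (cell _ off L) a with unclaimedBoxes-complete L a
... | inj₁ q        = inj₁ (∈-++⁺ʳ _ q)
... | inj₂ (eq , q) rewrite eq = inj₁ (∈-++⁺ˡ q)
unclaimedBoxes-complete (cell _ (on _) L) (there a) with unclaimedBoxes-complete L a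
... | inj₁ q        = inj₁ (∈-++⁺ʳ _ q)
... | inj₂ (eq , q) = inj₁ (∈-++⁺ˡ q)

count⇒Any : ∀ {P : Pred A 0ℓ} (P? : Decidable P) (xs : Vec A n) → 1 ℕ.≤ count P? xs → Any P xs
count⇒Any P? (x ∷ xs) pos with P? x
... | yes px = here px
... | no  _  = there (count⇒Any P? xs pos)

-- `bs` may still contain boxes claimed earlier, so it cannot be compared with `boxes` directly.
-- Instead `boxes` and `unclaimedBoxes L` are both duplicate-free and consist of the boxes on
-- undrawn lines, hence are permutations of each other.
boxes-unclaimed : (G : Position n) {bs : List (Position.Box G)} → Unique bs →
                  Lines [] s bs (Position.lines G) →
                  length (Position.boxes G) ≡ unclaimed s
boxes-unclaimed G u L = trans
  (↭-length (∼bag⇒↭ (unique∧set⇒bag unique (unclaimedBoxes-unique L u) (mk⇔ to from))))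
  (length-unclaimedBoxes L)
  where
  open Position G
  to : ∀ {q} → q ∈ boxes → q ∈ unclaimedBoxes L
  to q∈ with unclaimedBoxes-complete L (count⇒Any (borders? _) lines (degree≥1 q∈))
  ... | inj₁ q = q
  from : ∀ {q} → q ∈ unclaimedBoxes L → q ∈ boxes
  from q = Vecᴬ.lookupWith {R = const (_ ∈ boxes)} (λ l⊆ q∈ → l⊆ q∈) closed (unclaimedBoxes-sound L q)

filter-length : ∀ (f : A → ℕ) xs →
  length (filter (λ a → f a ℕ.≟ 0) xs) ℕ.+ length (filter (λ a → 1 ℕ.≤? f a) xs) ≡ length xs
filter-length f []       = refl
filter-length f (a ∷ as) with f a
... | zero  = cong suc (filter-length f as)
... | suc _ = trans (ℕ.+-suc _ _) (cong suc (filter-length f as))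

claimed-unclaimed : (G : Position (suc n)) (i : Fin (suc n)) {bs : List (Position.Box G)} → Unique bs →
  Lines [] s bs (Position.lines G) → Lines [] t bs (removeAt (Position.lines G) i) →
  claimed G i ≡ unclaimed s ∸ unclaimed t
claimed-unclaimed {s = s} {t = t} G i u L L′ = begin
  claimed G i
    ≡⟨ ℕ.m+n∸n≡m (claimed G i) (unclaimed t) ⟨
  claimed G i ℕ.+ unclaimed t ∸ unclaimed t
    ≡⟨ cong (λ k → claimed G i ℕ.+ k ∸ unclaimed t) (boxes-unclaimed (draw G i) u L′) ⟨
  claimed G i ℕ.+ length (boxes (draw G i)) ∸ unclaimed t
    ≡⟨ cong (_∸ unclaimed t) (filter-length (degree G (remaining G i)) (boxes G)) ⟩
  length (boxes G) ∸ unclaimed t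
    ≡⟨ cong (_∸ unclaimed t) (boxes-unclaimed G u L) ⟩
  unclaimed s ∸ unclaimed t
    ∎
  where
  open ≡-Reasoning
  open Position using (boxes; degree)

-- Agreement of `v` with `value`

min-≤ : ∀ (f : Fin (suc n) → ℤ) i → foldr₁ ℤ._⊓_ (tabulate f) ≤ f i
min-≤ {zero}  f zero    = ℤ.≤-refl
min-≤ {suc n} f zero    = ℤ.i⊓j≤i _ _
min-≤ {suc n} f (suc i) = ℤ.≤-trans (ℤ.i⊓j≤j (f zero) _) (min-≤ (f ∘ suc) i)

min-attained : ∀ (f : Fin (suc n) → ℤ) → ∃ λ i → foldr₁ ℤ._⊓_ (tabulate f) ≡ f i
min-attained {zero}  f = zero , refl
min-attained {suc n} f with ℤ.⊓-sel (f zero) (foldr₁ ℤ._⊓_ (tabulate (f ∘ suc)))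
... | inj₁ eq = zero , eq
... | inj₂ eq with i , eq′ ← min-attained (f ∘ suc) = suc i , trans eq eq′

v-value : (G : Position n) {bs : List (Position.Box G)} → Unique bs →
          Lines [] s bs (Position.lines G) → v G ≡ value s
v-value {zero}  {s = s} G u L rewrite lines-undrawn L = refl
v-value {suc n} {s = s} G u L = ℤ.≤-antisym v≤ v≥
  where
  option : Fin (suc n) → ℤ
  option i = afterMove (claimed G i) (v (draw G i))
  option-≡ : ∀ i {t} → Lines [] t _ (removeAt (Position.lines G) i) →
             option i ≡ afterMove (unclaimed s ∸ unclaimed t) (value t)
  option-≡ i L′ = cong₂ afterMove (claimed-unclaimed G i u L L′) (v-value (draw G i) u L′)
  v≤ : v G ≤ value s
  v≤ with t , d , eq ← value-attained s (subst (0 <_) (sym (lines-undrawn L)) ℕ.z<s)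
     with i , L′ ← locate L d
     = subst (v G ≤_) (trans (option-≡ i L′) (sym eq)) (min-≤ option i)
  v≥ : value s ≤ v G
  v≥ with i , eq ← min-attained option
     with t , d , L′ ← erase L i
     = subst (value s ≤_) (trans (sym (option-≡ i L′)) (sym eq)) (value-≤ d)

-- Unions of chains as states

ends-mapLine : ∀ {A B} (f : A → B) (inj : Injective _≡_ _≡_ f) l →
               ends (mapLine f inj l) ≡ map f (ends l)
ends-mapLine f inj (one _)     = refl
ends-mapLine f inj (two _ _ _) = refl

lines-map : ∀ {A B} (f : A → B) (inj : Injective _≡_ _≡_ f) {p s bs} {ls : Vec (Line A) n} →
            Lines p s bs ls → Lines (map f p) s (map f bs) (Vec.map (mapLine f inj) ls)
lines-map f inj none     = none
lines-map f inj (next L) = next (lines-map f inj L)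
lines-map {A = A} {B} f inj (cell {r = r} Bd c L) = cell (border-map Bd) (cell-map c) (lines-map f inj L)
  where
  border-map : ∀ {r x bs cs} → Border r x bs cs → Border (map f r) x (map f bs) (map f cs)
  border-map edge  = edge
  border-map inner = inner
  cell-map : ∀ {p b m n} {ls : Vec (Line A) m} {ks : Vec (Line A) n} → Cell (p ++ r) b ls ks →
             Cell (map f p ++ map f r) b (Vec.map (mapLine f inj) ls) (Vec.map (mapLine f inj) ks)
  cell-map off        = off
  cell-map {p} (on {l = l} eq) = on (trans (ends-mapLine f inj l) (trans (cong (map f) eq) (map-++ f p r)))

-- This is a chain without its first line, whose box `name zero` lies to the left of the row. Names
-- and lines are arbitrary functions so that the induction on `k` is precomposition with `suc`.
lines-full : ∀ k (name : Fin (suc k) → B) (f : Fin k → A) (e : A) (g : A → Line B) →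
  (∀ i → ends (g (f i)) ≡ name (inject₁ i) ∷ name (suc i) ∷ []) →
  ends (g e) ≡ name (fromℕ k) ∷ [] →
  Lines [] s bs ls →
  Lines (name zero ∷ []) (full k ∷ s)
        (List.tabulate (name ∘ suc) ++ bs) (Vec.map g (tabulate f ∷ʳ e) Vec.++ ls)
lines-full zero    name f e g eqs eq L = cell edge (on eq) (next L)
lines-full (suc k) name f e g eqs eq L =
  cell inner (on (eqs zero)) (lines-full k (name ∘ suc) (f ∘ suc) e g (eqs ∘ suc) eq L)

lines-chains : ∀ {cs} → All (1 ℕ.≤_) cs →
  Lines [] (fulls cs) (Position.boxes (chains cs)) (Position.lines (chains cs))
lines-chains []                        = none
lines-chains {suc k ∷ cs} (_ ∷ 1≤cs) =
  subst (λ bs → Lines [] (fulls (suc k ∷ cs))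
           (inj₁ zero ∷ bs ++ map inj₂ (Position.boxes (chains cs)))
           (Position.lines (chains (suc k ∷ cs))))
    (sym (map-tabulate {n = k} suc inj₁))
    (cell inner (on refl)
      (lines-full k inj₁ _ _ _ (λ _ → refl) refl (lines-map inj₂ _ (lines-chains 1≤cs))))

v-chains : ∀ {cs} → All (1 ℕ.≤_) cs → v (chains cs) ≡ value (fulls cs)
v-chains {cs} 1≤cs = v-value (chains cs) (Position.unique (chains cs)) (lines-chains 1≤cs)

-- The controlled value

cv-∷ : ∀ c cs → cv (c ∷ cs) ≡ cv cs + + c - + 4
cv-∷ c cs = arith (+ c) _
  where
  arith : ∀ c e → + 4 + (c - + 4 + e) ≡ + 4 + e + c - + 4
  arith = solve-∀

cv-↭ : ∀ {cs ds} → cs ↭ ds → cv cs ≡ cv ds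
cv-↭ ↭.refl          = refl
cv-↭ (↭.prep {cs} {ds} c p) =
  trans (cv-∷ c cs) (trans (cong (λ i → i + + c - + 4) (cv-↭ p)) (sym (cv-∷ c ds)))
cv-↭ (↭.swap {cs} {ds} c d p) = begin
  cv (c ∷ d ∷ cs)                      ≡⟨ cv-∷ c (d ∷ cs) ⟩
  cv (d ∷ cs) + + c - + 4              ≡⟨ cong (λ i → i + + c - + 4) (cv-∷ d cs) ⟩
  cv cs + + d - + 4 + + c - + 4        ≡⟨ cong (λ i → i + + d - + 4 + + c - + 4) (cv-↭ p) ⟩
  cv ds + + d - + 4 + + c - + 4        ≡⟨ arith (cv ds) (+ c) (+ d) ⟩
  cv ds + + c - + 4 + + d - + 4        ≡⟨ cong (λ i → i + + d - + 4) (cv-∷ c ds) ⟨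
  cv (c ∷ ds) + + d - + 4              ≡⟨ cv-∷ d (c ∷ ds) ⟨
  cv (d ∷ c ∷ ds)                      ∎
  where
  open ≡-Reasoning
  arith : ∀ e c d → e + d - + 4 + c - + 4 ≡ e + c - + 4 + d - + 4
  arith = solve-∀
cv-↭ (↭.trans p q)   = trans (cv-↭ p) (cv-↭ q)

cv-≥4 : ∀ {cs} → All (4 ℕ.≤_) cs → + 4 ≤ cv cs
cv-≥4 []               = ℤ.≤-refl
cv-≥4 {c ∷ cs} (4≤c ∷ 4≤cs) = shift-≤ (ℤ.+-mono-≤ (cv-≥4 4≤cs) (+≤+ 4≤c))
  (trans (arith (cv cs) (+ c)) (cong (_- + 4) (sym (cv-∷ c cs))))
  where
  arith : ∀ e c → e + c - (+ 4 + + 4) ≡ e + c - + 4 - + 4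
  arith = solve-∀

between : ∀ {i} → + 1 ≤ i → i ≤ + 2 → i ≡ + 1 ⊎ i ≡ + 2
between (+≤+ (s≤s {n = zero} z≤n))        (+≤+ _) = inj₁ refl
between (+≤+ (s≤s {n = suc zero} z≤n))    (+≤+ _) = inj₂ refl
between (+≤+ (s≤s {n = suc (suc _)} z≤n)) (+≤+ (s≤s (s≤s ())))

double-≤0 : ∀ {i} q → i + (+ q + + q) ≤ i → q ≡ 0
double-≤0 zero        _ = refl
double-≤0 {i} (suc q) p =
  contradiction (shift-≤ {k = + suc q + + suc q} {0ℤ} p (arith i (+ suc q + + suc q))) λ { (+≤+ ()) }
  where
  arith : ∀ i k → i - (i + k) ≡ 0ℤ - k
  arith = solve-∀

-- One form for both signs of `c`: removing a chain may change the sign of the controlled value, and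
-- the induction hypothesis has to apply regardless.
record Controlled (v c : ℤ) : Set where
  constructor controlled
  field
    excess   : ℕ
    v≡       : v ≡ c + (+ excess + + excess)
    positive : + 1 ≤ v
    tight    : excess ≡ 0 ⊎ v ≤ + 2

has-three : ∀ {cs} → All (3 ℕ.≤_) cs → All (4 ℕ.≤_) cs ⊎ ∃ λ ds → cs ↭ 3 ∷ ds
has-three [] = inj₁ []
has-three {c ∷ cs} (3≤c ∷ 3≤cs) with ℕ.m≤n⇒m<n∨m≡n 3≤c
... | inj₂ refl = inj₂ (cs , ↭-refl)
... | inj₁ 4≤c  = Sum.map (4≤c ∷_)
  (λ { (ds , p) → c ∷ ds , ↭.trans (↭.prep c p) (↭.swap c 3 ↭-refl) }) (has-three 3≤cs)

half-positive : ∀ {i} → + 2 ≤ i + i → + 1 ≤ i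
half-positive {+ zero}  (+≤+ ())
half-positive {+ suc _} _ = +≤+ (s≤s z≤n)
half-positive {ℤ.-[1+ _ ]} ()

fulls-controlled : ∀ n {cs} → length cs ≡ suc n → All (3 ℕ.≤_) cs →
                   Controlled (value (fulls cs)) (cv cs)
fulls-controlled zero {c ∷ []} refl (3≤c ∷ []) =
  controlled 0 V≡c (subst (+ 1 ≤_) (sym V≡) (+≤+ (3≤⇒1≤ 3≤c))) (inj₁ refl)
  where
  V = value (fulls (c ∷ []))
  V≤ : V ≤ + c
  V≤ with fulls-≤ {c} {[]} (3≤⇒1≤ 3≤c) []
  ... | inj₁ h = subst (_≤ + c) (ℤ.+-identityʳ V) h
  ... | inj₂ h = ℤ.≤-trans (ℤ.i≤i+j V (+ 4)) (subst (V + + 4 ≤_) (ℤ.+-identityˡ (+ c)) h)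
  V≥ : + c ≤ V
  V≥ with d , ds , p , h , _ ← fulls-≥ c [] (3≤c ∷ [])
     with refl ← ↭-singleton-inv (↭-sym p) = subst (+ c ≤_) (ℤ.+-identityʳ V) h
  V≡ : V ≡ + c
  V≡ = ℤ.≤-antisym V≤ V≥
  V≡c : V ≡ cv (c ∷ []) + 0ℤ
  V≡c = trans V≡ (arith (+ c))
    where
    arith : ∀ c → c ≡ + 4 + (c - + 4 + 0ℤ) + 0ℤ
    arith = solve-∀
fulls-controlled (suc n) {c ∷ cs} len 3≤ with d , ds , p , V≥₁ , V≥₂ ← fulls-≥ c cs 3≤
  with 3≤d ∷ 3≤ds ← All-resp-↭ p 3≤
  with controlled q W≡ W≥1 W-tight
         ← fulls-controlled n {ds} (ℕ.suc-injective (trans (sym (↭-length p)) len)) 3≤ds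
  = let q′ , eq , r = excess in controlled q′ eq V≥1 (V-tight q′ eq r)
  where
  V = value (fulls (c ∷ cs))
  W = value (fulls ds)
  C = cv (c ∷ cs)
  C≡ : C ≡ cv ds + + d - + 4
  C≡ = trans (cv-↭ p) (cv-∷ d ds)
  upper : ∀ {d ds} → c ∷ cs ↭ d ∷ ds → V + value (fulls ds) ≤ + d ⊎ V + + 4 ≤ value (fulls ds) + + d
  upper {d} {ds} p with 3≤d ∷ 3≤ds ← All-resp-↭ p 3≤ =
    subst (λ v → v + value (fulls ds) ≤ + d ⊎ v + + 4 ≤ value (fulls ds) + + d)
      (sym (value-↭ (map⁺ full p))) (fulls-≤ (3≤⇒1≤ 3≤d) (All.map 3≤⇒1≤ 3≤ds))

  V≡ : ∀ q′ → V + + 4 ≡ W + + d + (+ q′ + + q′) - (+ q + + q) → V ≡ C + (+ q′ + + q′)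
  V≡ q′ eq = begin
    V                              ≡⟨ arith₁ V ⟩
    V + + 4 - + 4                  ≡⟨ cong (_- + 4) eq ⟩
    W + + d + k′ - k - + 4         ≡⟨ cong (λ w → w + + d + k′ - k - + 4) W≡ ⟩
    cv ds + k + + d + k′ - k - + 4 ≡⟨ arith₂ (cv ds) (+ d) k k′ ⟩
    cv ds + + d - + 4 + k′         ≡⟨ cong (_+ k′) C≡ ⟨
    C + k′                         ∎
    where
    open ≡-Reasoning
    k  = + q + + q
    k′ = + q′ + + q′
    arith₁ : ∀ v → v ≡ v + + 4 - + 4
    arith₁ = solve-∀
    arith₂ : ∀ e d k l → e + k + d + l - k - + 4 ≡ e + d - + 4 + l
    arith₂ = solve-∀

  same : V + + 4 ≤ W + + d → V ≡ C + (+ q + + q)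
  same V≤ = V≡ q (trans (ℤ.≤-antisym V≤ V≥₂) (arith (W + + d) (+ q + + q)))
    where
    arith : ∀ i k → i ≡ i + k - k
    arith = solve-∀

  V≥1 : + 1 ≤ V
  -- Adding the two lower bounds cancels `W` and leaves V + V ≥ d + d - 4, which is at least 2.
  V≥1 = half-positive (shift-≤
    (ℤ.+-mono-≤ (ℤ.+-mono-≤ V≥₁ V≥₂) (ℤ.+-mono-≤ (+≤+ 3≤d) (+≤+ 3≤d))) (arith V W (+ d)))
    where
    arith : ∀ v w d → v + w + (v + + 4) + (d + d) - (d + (w + d) + (+ 3 + + 3)) ≡ v + v - + 2
    arith = solve-∀

  excess : ∃ λ q′ → V ≡ C + (+ q′ + + q′) × (q′ ≡ q ⊎ W ≤ + 2)
  excess with upper p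
  ... | inj₂ V≤ = q , same V≤ , inj₁ refl
  ... | inj₁ V≤ with ℤ.≤-antisym V≤ V≥₁
  ...   | V+W≡d with between W≥1 W≤2
    where
    W≤2 : W ≤ + 2
    -- Where taking everything is at least as good as the double deal, the bounds add up to W + W ≤
    -- 4.
    W≤2 = shift-≤
      (half-positive {+ 3 - W} (shift-≤ (ℤ.+-mono-≤ V≤ V≥₂) (arith₁ V W (+ d)))) (arith₂ W)
      where
      arith₁ : ∀ v w d → d + (v + + 4) - (v + w + (w + d)) ≡ + 3 - w + (+ 3 - w) - + 2
      arith₁ = solve-∀
      arith₂ : ∀ w → + 3 - w - + 1 ≡ + 2 - w
      arith₂ = solve-∀
  -- Taking everything beats the double deal by 4 - 2W = 2 here, the only case in which the excess
  -- grows.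
  ...     | inj₁ W≡1 = suc q , V≡ (suc q) eq , inj₂ (subst (_≤ + 2) (sym W≡1) (+≤+ (s≤s z≤n)))
    where
    arith₁ : ∀ v → v + + 4 ≡ + 1 + (v + + 1) + + 2
    arith₁ = solve-∀
    arith₂ : ∀ i q → i + + 2 ≡ i + (+ 1 + q + (+ 1 + q)) - (q + q)
    arith₂ = solve-∀
    eq : V + + 4 ≡ W + + d + (+ suc q + + suc q) - (+ q + + q)
    eq = trans (arith₁ V) (trans (cong (λ w → w + (V + w) + + 2) (sym W≡1))
           (trans (cong (λ i → W + i + + 2) V+W≡d) (arith₂ (W + + d) (+ q))))
  -- Both replies are worth the same at `W` = 2.
  ...     | inj₂ W≡2 = q , same (ℤ.≤-reflexive eq) , inj₁ refl
    where
    arith : ∀ v → v + + 4 ≡ + 2 + (v + + 2)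
    arith = solve-∀
    eq : V + + 4 ≡ W + + d
    eq = trans (arith V) (trans (cong (λ w → w + (V + w)) (sym W≡2)) (cong (λ i → W + i) V+W≡d))

  V-tight : ∀ q′ → V ≡ C + (+ q′ + + q′) → q′ ≡ q ⊎ W ≤ + 2 → q′ ≡ 0 ⊎ V ≤ + 2
  V-tight q′ eq r with has-three 3≤
  -- Without a 3-chain `W` is at least 4, which rules out the alternative `W ≤ + 2` in `r` and in
  -- `W-tight`.
  ... | inj₁ 4≤ with _ ∷ 4≤ds ← All-resp-↭ p 4≤ = inj₁ (trans q′≡q q≡0)
    where
    W≥4 : + 4 ≤ W
    W≥4 = subst (+ 4 ≤_) (sym W≡) (ℤ.≤-trans (cv-≥4 4≤ds) (ℤ.i≤i+j (cv ds) (+ q + + q)))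
    W≰2 : ¬ W ≤ + 2
    W≰2 W≤2 = contradiction (ℤ.≤-trans W≥4 W≤2) λ { (+≤+ (s≤s (s≤s ()))) }
    q′≡q : q′ ≡ q
    q′≡q = Sum.[ id , (λ W≤2 → contradiction W≤2 W≰2) ] r
    q≡0 : q ≡ 0
    q≡0 = Sum.[ id , (λ W≤2 → contradiction W≤2 W≰2) ] W-tight
  -- The 3-chain may differ from the optimal `d`: opening it is just one candidate for the minimum,
  -- bounding `V` by 3 - W′ or by W′ - 1, where W′ is the value of `fulls es`.
  ... | inj₂ (es , p₃) with _ ∷ 3≤es ← All-resp-↭ p₃ 3≤
      with controlled q″ W′≡ W′≥1 W′-tight
             ← fulls-controlled n {es} (ℕ.suc-injective (trans (sym (↭-length p₃)) len)) 3≤es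
      with upper p₃ | W′-tight
  ...   | inj₁ V≤ | _ = inj₂ (shift-≤ (ℤ.+-mono-≤ V≤ W′≥1) (arith V (value (fulls es))))
    where
    arith : ∀ v w → + 3 + w - (v + w + + 1) ≡ + 2 - v
    arith = solve-∀
  ...   | inj₂ V≤ | inj₁ refl = inj₁ (double-≤0 q′ (subst (_≤ C) eq (shift-≤ V≤
          (trans (cong (λ w → w + + 3 - (V + + 4)) W′≡) (trans (arith (cv es) V)
            (cong (_- V) (sym (trans (cv-↭ p₃) (cv-∷ 3 es)))))))))
    where
    arith : ∀ e v → e + 0ℤ + + 3 - (v + + 4) ≡ e + + 3 - + 4 - v
    arith = solve-∀
  -- Here `V` is even at most 1; the added 0 ≤ 1 pads this to the goal.
  ...   | inj₂ V≤ | inj₂ W′≤2 = inj₂ (shift-≤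
          (ℤ.+-mono-≤ (ℤ.+-mono-≤ V≤ W′≤2) (+≤+ (z≤n {1}))) (arith V (value (fulls es))))
    where
    arith : ∀ v w → w + + 3 + + 2 + + 1 - (v + + 4 + w + 0ℤ) ≡ + 2 - v
    arith = solve-∀

chains-controlled : ∀ {cs} → 1 ℕ.≤ length cs → All (3 ℕ.≤_) cs →
                    Controlled (v (chains cs)) (cv cs)
chains-controlled {c ∷ cs} (s≤s z≤n) 3≤ = subst (λ i → Controlled i (cv (c ∷ cs)))
  (sym (v-chains (All.map 3≤⇒1≤ 3≤))) (fulls-controlled (length cs) refl 3≤)

controlled-≥1 : ∀ {v c} → Controlled v c → + 1 ≤ c → v ≡ c
controlled-≥1 {c = c} (controlled zero v≡ _ _) _ = trans v≡ (ℤ.+-identityʳ c)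
-- A positive excess over `c` at least 1 would make `v` at least 3.
controlled-≥1 {c = c} (controlled (suc q) v≡ _ (inj₂ v≤2)) 1≤c = contradiction
  (ℤ.≤-trans (ℤ.+-mono-≤ 1≤c (+≤+ 2≤)) (subst (_≤ + 2) v≡ v≤2)) λ { (+≤+ (s≤s (s≤s ()))) }
  where
  2≤ : 2 ℕ.≤ suc q ℕ.+ suc q
  2≤ = ℕ.+-mono-≤ (s≤s z≤n) (s≤s z≤n)

controlled-≤0 : ∀ {v c} → Controlled v c → c ≤ + 0 → (v ≡ + 1 ⊎ v ≡ + 2) × + 2 ∣ (v - c)
controlled-≤0 {v} {c} (controlled q v≡ v≥1 tight) c≤0 = between v≥1 (v≤2 tight) , divides q (begin
  ℤ.∣ v - c ∣                  ≡⟨ cong (λ i → ℤ.∣ i - c ∣) v≡ ⟩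
  ℤ.∣ c + (+ q + + q) - c ∣    ≡⟨ cong ℤ.∣_∣ (arith c (+ q + + q)) ⟩
  q ℕ.+ q                      ≡⟨ cong (q ℕ.+_) (ℕ.+-identityʳ q) ⟨
  2 ℕ.* q                      ≡⟨ ℕ.*-comm 2 q ⟩
  q ℕ.* 2                      ∎)
  where
  open ≡-Reasoning
  arith : ∀ c k → c + k - c ≡ k
  arith = solve-∀
  v≤2 : q ≡ 0 ⊎ v ≤ + 2 → v ≤ + 2
  v≤2 (inj₁ refl) =
    ℤ.≤-trans (ℤ.≤-reflexive (trans v≡ (ℤ.+-identityʳ c))) (ℤ.≤-trans c≤0 (+≤+ z≤n))
  v≤2 (inj₂ v≤2)  = v≤2

theorem10 : ((cs : List ℕ) → 1 ℕ.≤ length cs → All (4 ℕ.≤_) cs →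
    v (chains cs) ≡ cv cs × + 4 ≤ cv cs)
    ×
    ((cs : List ℕ) → 1 ℕ.≤ length cs → All (3 ℕ.≤_) cs →
    (+ 1 ≤ cv cs → v (chains cs) ≡ cv cs)
    ×
    (cv cs ≤ + 0 →
    (v (chains cs) ≡ + 1 ⊎ v (chains cs) ≡ + 2) × + 2 ∣ (v (chains cs) - cv cs)))
theorem10 =
    (λ cs 1≤n 4≤ →
      controlled-≥1 (chains-controlled 1≤n (All.map (ℕ.≤-trans (ℕ.n≤1+n 3)) 4≤))
        (ℤ.≤-trans (+≤+ (s≤s z≤n)) (cv-≥4 4≤))
      , cv-≥4 4≤)
  , λ cs 1≤n 3≤ →
      let ctl = chains-controlled 1≤n 3≤ in controlled-≥1 ctl , controlled-≤0 ctl
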